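{- There exists an absolute constant $c>0$ such that the following holds for every integer $d\ge 1$. For every finite bipartite graph $G=(L\cup R,E)$ in which every online vertex $j\in R$ has degree at most $d$, and for every arrival order of the vertices of $R$, the water-filling algorithm for fractional online bipartite matching produces a fractional matching $\{x_{i,j}\}$ with $$\sum_{(i,j)\in E}x_{i,j}\;\ge\;\frac{e-1}{e}\Bigl(1+\frac{c}{d}\Bigr)\cdot \mathrm{OPT}(G),$$ where $\mathrm{OPT}(G)$ is the maximum value of a fractional matching of $G$. That is, the water-filling algorithm achieves a competitive ratio of $\frac{e-1}{e}(1+c/d)$ for the $d$-bounded degree fractional online bipartite matching problem in the worst-case model.
   Context: Fractional online bipartite matching: $G=(L\cup R,E)$ is a finite bipartite graph; $L$ (offline side) is known in advance, and the vertices of $R$ (online side) arrive one by one. When $j\in R$ arrives, its neighbor set $N(j)\subseteq L$ is revealed and the algorithm must irrevocably choose values $x_{i,j}\ge 0$ for $i\in N(j)$. A fractional matching is a vector $(x_{i,j})_{(i,j)\in E}$ with $x_{i,j}\ge 0$, $\sum_{j\in N(i)}x_{i,j}\le 1$ for all $i\in L$, and $\sum_{i\in N(j)}x_{i,j}\le 1$ for all $j\in R$; its value is $\sum_{(i,j)\in E}x_{i,j}$. The water-level $y_i$ of $i\in L$ at a given time is the sum of the values $x_{i,j}$ allocated to $i$ so far. Water-filling algorithm: all water-levels start at $0$. When $j$ arrives, as long as some neighbor $i\in N(j)$ has $y_i<1$ and $\sum_{i\in N(j)}x_{i,j}<1$, the algorithm allocates $j$ continuously among the neighbors of $j$ having minimum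 water-level, so as to increase their water-levels equally. Equivalently, if $y_i$ denotes the water-level of $i$ just before the arrival of $j$, then $x_{i,j}=\max(0,\ell-y_i)$ for $i\in N(j)$, where $\ell\in[0,1]$ is the largest number with $\sum_{i\in N(j)}\max(0,\ell-y_i)\le 1$. "$d$-bounded degree" means that every vertex on the online side has degree at most $d$. -}

module Defs where

open import Data.Bool.Base using (true; false)
open import Data.Fin.Base using (Fin; zero; suc)
import Data.Fin.Properties as Fin
open import Data.Fin.Permutation using (Permutation′; _⟨$⟩ʳ_)
open import Data.Fin.Subset using (Subset; _∈_; _∩_; ⊤)
import Data.Fin.Subset as Subset
open import Data.Integer.Base using (+_)
import Data.Integer.Base as ℤ
import Data.Integer.Properties as ℤ
open import Data.Nat.Base using (ℕ; zero; suc; NonZero; _!)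
import Data.Nat.Base as ℕ
import Data.Nat.Properties as ℕ
open import Data.Product.Base using (∃-syntax; _×_; _,_; proj₁; proj₂)
open import Data.Rational.Base using (ℚ; mkℚ; 0ℚ; 1ℚ; ½)
import Data.Rational.Base as ℚ
import Data.Rational.Properties as ℚ
import Data.Rational.Unnormalised.Base as ℚᵘ
import Data.Rational.Unnormalised.Properties as ℚᵘ
open import Data.Rational.Solver using (module +-*-Solver)
open import Data.Sum.Base using (inj₁; inj₂)
open import Data.Vec.Base using ([]; _∷_; tabulate; lookup)
open import Relation.Binary.PropositionalEquality
  using (_≡_; refl; sym; trans; cong; cong₂; subst)
open import Relation.Nullary.Decidable using (yes; no; does)
open import Relation.Nullary.Negation using (contradiction)

module _ where
  open import Data.Rational.Base hiding (NonZero; ℚ)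
  open import Data.Rational.Properties
  open ≤-Reasoning

  ∣p∣≤q : ∀ {p q} → p ≤ q → - p ≤ q → ∣ p ∣ ≤ q
  ∣p∣≤q {p} p≤q -p≤q with ∣p∣≡p∨∣p∣≡-p p
  ... | inj₁ eq = subst (_≤ _) (sym eq) p≤q
  ... | inj₂ eq = subst (_≤ _) (sym eq) -p≤q

  p≤∣p∣ : ∀ p → p ≤ ∣ p ∣
  p≤∣p∣ p with ∣p∣≡p∨∣p∣≡-p p | ≤-total 0ℚ p
  ... | inj₁ eq | _        = ≤-reflexive (sym eq)
  ... | inj₂ _  | inj₁ 0≤p = ≤-reflexive (sym (0≤p⇒∣p∣≡p 0≤p))
  ... | inj₂ _  | inj₂ p≤0 = ≤-trans p≤0 (0≤∣p∣ p)

  ∣p-q∣≡∣q-p∣ : ∀ p q → ∣ p - q ∣ ≡ ∣ q - p ∣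
  ∣p-q∣≡∣q-p∣ p q = trans (cong ∣_∣ (solve 2 (λ a b → a :- b := :- (b :- a)) refl p q))
                          (∣-p∣≡∣p∣ (q - p))
    where open +-*-Solver

  close⇒≤ : ∀ {p q ε} → ∣ p - q ∣ ≤ ε → p ≤ q + ε
  close⇒≤ {p} {q} {ε} h = begin
    p             ≡⟨ solve 2 (λ a b → a := b :+ (a :- b)) refl p q ⟩
    q + (p - q)   ≤⟨ +-monoʳ-≤ q (≤-trans (p≤∣p∣ (p - q)) h) ⟩
    q + ε         ∎
    where open +-*-Solver

  ≤⇒diff≤ : ∀ {p q ε} → p ≤ q + ε → p - q ≤ ε
  ≤⇒diff≤ {p} {q} {ε} h = begin
    p - q         ≤⟨ +-monoˡ-≤ (- q) h ⟩
    (q + ε) - q   ≡⟨ solve 2 (λ b c → (b :+ c) :- b := c) refl q ε ⟩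
    ε             ∎
    where open +-*-Solver

  ≤⇒close : ∀ {p q ε} → p ≤ q + ε → q ≤ p + ε → ∣ p - q ∣ ≤ ε
  ≤⇒close {p} {q} {ε} h k = ∣p∣≤q (≤⇒diff≤ h)
    (subst (_≤ ε) (solve 2 (λ a b → b :- a := :- (a :- b)) refl p q) (≤⇒diff≤ k))
    where open +-*-Solver

  *-mono-≤-nonNeg : ∀ {p q r s} → 0ℚ ≤ p → 0ℚ ≤ s → p ≤ q → r ≤ s → p * r ≤ q * s
  *-mono-≤-nonNeg {p} {q} {r} {s} 0≤p 0≤s p≤q r≤s = ≤-trans
    (*-monoˡ-≤-nonNeg p {{nonNegative 0≤p}} r≤s)
    (*-monoʳ-≤-nonNeg s {{nonNegative 0≤s}} p≤q)

  *-pos : ∀ {p q} → 0ℚ < p → 0ℚ < q → 0ℚ < p * q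
  *-pos {p} {q} 0<p 0<q =
    positive⁻¹ (p * q) {{pos*pos⇒pos p {{positive 0<p}} q {{positive 0<q}}}}

  0<½ : 0ℚ < ½
  0<½ = positive⁻¹ ½

  halve : ∀ ε → ε * ½ + ε * ½ ≡ ε
  halve ε = trans (sym (*-distribˡ-+ ε ½ ½)) (*-identityʳ ε)

  recip : ℚ → ℚ
  recip q with q ≟ 0ℚ
  ... | yes _   = 0ℚ
  ... | no q≢0 = (1/ q) {{≢-nonZero q≢0}}

  *-recip : ∀ {q} → 0ℚ < q → q * recip q ≡ 1ℚ
  *-recip {q} 0<q with q ≟ 0ℚ
  ... | yes q≡0 = contradiction (sym q≡0) (<⇒≢ 0<q)
  ... | no q≢0 = *-inverseʳ q {{≢-nonZero q≢0}}

  recip-pos : ∀ {q} → 0ℚ < q → 0ℚ < recip q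
  recip-pos {q} 0<q with q ≟ 0ℚ
  ... | yes q≡0 = contradiction (sym q≡0) (<⇒≢ 0<q)
  ... | no q≢0 = positive⁻¹ _ {{1/pos⇒pos q {{positive 0<q}}}}

  IsCauchy : (ℕ → ℚ) → Set
  IsCauchy s = ∀ ε → 0ℚ < ε →
    ∃[ N ] (∀ m n → N ℕ.≤ m → N ℕ.≤ n → ∣ s m - s n ∣ ≤ ε)

  const-cauchy : ∀ q → IsCauchy (λ _ → q)
  const-cauchy q ε 0<ε = 0 , λ _ _ _ _ →
    ≤-trans (≤-reflexive (cong ∣_∣ (+-inverseʳ q))) (<⇒≤ 0<ε)

  +-cauchy : ∀ {x y} → IsCauchy x → IsCauchy y → IsCauchy (λ n → x n + y n)
  +-cauchy {x} {y} cx cy ε 0<ε with cx (ε * ½) (*-pos 0<ε 0<½) | cy (ε * ½) (*-pos 0<ε 0<½)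
  ... | M , hx | N , hy = M ℕ.⊔ N , λ m n p q → begin
    ∣ (x m + y m) - (x n + y n) ∣
      ≡⟨ cong ∣_∣ (solve 4 (λ a b c d → (a :+ b) :- (c :+ d) := (a :- c) :+ (b :- d)) refl
                     (x m) (y m) (x n) (y n)) ⟩
    ∣ (x m - x n) + (y m - y n) ∣
      ≤⟨ ∣p+q∣≤∣p∣+∣q∣ (x m - x n) (y m - y n) ⟩
    ∣ x m - x n ∣ + ∣ y m - y n ∣
      ≤⟨ +-mono-≤ (hx m n (ℕ.m⊔n≤o⇒m≤o M N p) (ℕ.m⊔n≤o⇒m≤o M N q))
                  (hy m n (ℕ.m⊔n≤o⇒n≤o M N p) (ℕ.m⊔n≤o⇒n≤o M N q)) ⟩
    ε * ½ + ε * ½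
      ≡⟨ halve ε ⟩
    ε ∎
    where open +-*-Solver

  neg-cauchy : ∀ {x} → IsCauchy x → IsCauchy (λ n → - x n)
  neg-cauchy {x} cx ε 0<ε with cx ε 0<ε
  ... | N , h = N , λ m n p q →
    subst (_≤ ε)
      (cong ∣_∣ (solve 2 (λ a b → a :- b := :- b :- :- a) refl (x n) (x m)))
      (h n m q p)
    where open +-*-Solver

  ⊔-cauchy : ∀ {x y} → IsCauchy x → IsCauchy y → IsCauchy (λ n → x n ⊔ y n)
  ⊔-cauchy {x} {y} cx cy ε 0<ε with cx ε 0<ε | cy ε 0<ε
  ... | M , hx | N , hy = M ℕ.⊔ N , λ m n p q →
    ≤⇒close (half m n p q) (half n m q p)
    where
    half : ∀ m n → M ℕ.⊔ N ℕ.≤ m → M ℕ.⊔ N ℕ.≤ n →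
           x m ⊔ y m ≤ (x n ⊔ y n) + ε
    half m n p q = ⊔-lub {(x n ⊔ y n) + ε} {x m} {y m}
      (≤-trans (close⇒≤ {x m} {x n} (hx m n (ℕ.m⊔n≤o⇒m≤o M N p) (ℕ.m⊔n≤o⇒m≤o M N q)))
               (+-monoˡ-≤ ε {x n} {x n ⊔ y n} (p≤p⊔q (x n) (y n))))
      (≤-trans (close⇒≤ {y m} {y n} (hy m n (ℕ.m⊔n≤o⇒n≤o M N p) (ℕ.m⊔n≤o⇒n≤o M N q)))
               (+-monoˡ-≤ ε {y n} {x n ⊔ y n} (p≤q⊔p (x n) (y n))))

  bound : ∀ {x} → IsCauchy x → ∃[ B ] 0ℚ < B × ∃[ N ] (∀ n → N ℕ.≤ n → ∣ x n ∣ ≤ B)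
  bound {x} cx with cx 1ℚ (positive⁻¹ 1ℚ)
  ... | N , h = ∣ x N ∣ + 1ℚ , B>0 , N , λ n p → begin
    ∣ x n ∣
      ≡⟨ cong ∣_∣ (solve 2 (λ a b → a := b :+ (a :- b)) refl (x n) (x N)) ⟩
    ∣ x N + (x n - x N) ∣
      ≤⟨ ∣p+q∣≤∣p∣+∣q∣ (x N) (x n - x N) ⟩
    ∣ x N ∣ + ∣ x n - x N ∣
      ≤⟨ +-monoʳ-≤ ∣ x N ∣ (h n N p ℕ.≤-refl) ⟩
    ∣ x N ∣ + 1ℚ ∎
    where
    open +-*-Solver
    B>0 : 0ℚ < ∣ x N ∣ + 1ℚ
    B>0 = +-mono-≤-< (0≤∣p∣ (x N)) (positive⁻¹ 1ℚ)

  *-close : ∀ a b c d {B C η θ} → 0ℚ ≤ η → 0ℚ ≤ θ → ∣ a ∣ ≤ B → ∣ d ∣ ≤ C →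
            ∣ b - d ∣ ≤ η → ∣ a - c ∣ ≤ θ → ∣ a * b - c * d ∣ ≤ B * η + C * θ
  *-close a b c d {B} {C} {η} {θ} 0≤η 0≤θ a≤B d≤C b-d≤η a-c≤θ = begin
    ∣ a * b - c * d ∣
      ≡⟨ cong ∣_∣ (solve 4 (λ a b c d → a :* b :- c :* d := a :* (b :- d) :+ d :* (a :- c))
                     refl a b c d) ⟩
    ∣ a * (b - d) + d * (a - c) ∣
      ≤⟨ ∣p+q∣≤∣p∣+∣q∣ (a * (b - d)) (d * (a - c)) ⟩
    ∣ a * (b - d) ∣ + ∣ d * (a - c) ∣
      ≡⟨ cong₂ _+_ (∣p*q∣≡∣p∣*∣q∣ a (b - d)) (∣p*q∣≡∣p∣*∣q∣ d (a - c)) ⟩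
    ∣ a ∣ * ∣ b - d ∣ + ∣ d ∣ * ∣ a - c ∣
      ≤⟨ +-mono-≤ (*-mono-≤-nonNeg (0≤∣p∣ a) 0≤η a≤B b-d≤η)
                  (*-mono-≤-nonNeg (0≤∣p∣ d) 0≤θ d≤C a-c≤θ) ⟩
    B * η + C * θ ∎
    where open +-*-Solver

  tol : ∀ ε B → 0ℚ < ε → 0ℚ < B → ∃[ η ] 0ℚ < η × B * η ≡ ε * ½
  tol ε B 0<ε 0<B = ε * ½ * recip B , *-pos (*-pos 0<ε 0<½) (recip-pos 0<B) ,
    trans (swap B (ε * ½) (recip B))
      (trans (cong (ε * ½ *_) (*-recip 0<B)) (*-identityʳ (ε * ½)))
    where
    swap : ∀ p q r → p * (q * r) ≡ q * (p * r)
    swap p q r = trans (sym (*-assoc p q r)) (trans (cong (_* r) (*-comm p q)) (*-assoc q p r))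

  *-cauchy : ∀ {x y} → IsCauchy x → IsCauchy y → IsCauchy (λ n → x n * y n)
  *-cauchy {x} {y} cx cy ε 0<ε = from (bound {x} cx) (bound {y} cy)
    where
    Goal : Set
    Goal = ∃[ K ] (∀ m n → K ℕ.≤ m → K ℕ.≤ n → ∣ x m * y m - x n * y n ∣ ≤ ε)

    Bounded : (ℕ → ℚ) → Set
    Bounded s = ∃[ B ] 0ℚ < B × ∃[ N ] (∀ n → N ℕ.≤ n → ∣ s n ∣ ≤ B)

    from : Bounded x → Bounded y → Goal
    from (B , 0<B , M , hB) (C , 0<C , N , hC) = from-tol (tol ε B 0<ε 0<B) (tol ε C 0<ε 0<C)
      where
      from-tol : ∃[ η ] 0ℚ < η × B * η ≡ ε * ½ → ∃[ θ ] 0ℚ < θ × C * θ ≡ ε * ½ → Goal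
      from-tol (η , 0<η , Bη≡) (θ , 0<θ , Cθ≡) = (M ℕ.⊔ N) ℕ.⊔ (M' ℕ.⊔ N') , close
        where
        M' = proj₁ (cx θ 0<θ)
        N' = proj₁ (cy η 0<η)
        close : ∀ m n → (M ℕ.⊔ N) ℕ.⊔ (M' ℕ.⊔ N') ℕ.≤ m → (M ℕ.⊔ N) ℕ.⊔ (M' ℕ.⊔ N') ℕ.≤ n →
                ∣ x m * y m - x n * y n ∣ ≤ ε
        close m n p q = ≤-trans
          (*-close (x m) (y m) (x n) (y n) (<⇒≤ 0<η) (<⇒≤ 0<θ)
            (hB m (ℕ.m⊔n≤o⇒m≤o M N (ℕ.m⊔n≤o⇒m≤o (M ℕ.⊔ N) _ p)))
            (hC n (ℕ.m⊔n≤o⇒n≤o M N (ℕ.m⊔n≤o⇒m≤o (M ℕ.⊔ N) _ q)))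
            (proj₂ (cy η 0<η) m n (ℕ.m⊔n≤o⇒n≤o M' N' m₂) (ℕ.m⊔n≤o⇒n≤o M' N' n₂))
            (proj₂ (cx θ 0<θ) m n (ℕ.m⊔n≤o⇒m≤o M' N' m₂) (ℕ.m⊔n≤o⇒m≤o M' N' n₂)))
          (≤-reflexive (trans (cong₂ _+_ Bη≡ Cθ≡) (halve ε)))
          where
          m₂ = ℕ.m⊔n≤o⇒n≤o (M ℕ.⊔ N) _ p
          n₂ = ℕ.m⊔n≤o⇒n≤o (M ℕ.⊔ N) _ q

  recip-close : ∀ a b r s {δ ε} → a * r ≡ 1ℚ → b * s ≡ 1ℚ → 0ℚ ≤ r → 0ℚ ≤ s →
                0ℚ ≤ δ → 0ℚ ≤ ε → δ ≤ a → δ ≤ b →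
                ∣ b - a ∣ ≤ ε * (δ * δ) → ∣ r - s ∣ ≤ ε
  recip-close a b r s {δ} {ε} ar≡1 bs≡1 0≤r 0≤s 0≤δ 0≤ε δ≤a δ≤b b-a≤ = begin
    ∣ r - s ∣
      ≡⟨ cong ∣_∣ (cong₂ _-_ (sym (trans (cong (r *_) bs≡1) (*-identityʳ r)))
                             (sym (trans (cong (s *_) ar≡1) (*-identityʳ s)))) ⟩
    ∣ r * (b * s) - s * (a * r) ∣
      ≡⟨ cong ∣_∣ (solve 4 (λ a b r s → r :* (b :* s) :- s :* (a :* r) := (b :- a) :* (r :* s))
                     refl a b r s) ⟩
    ∣ (b - a) * (r * s) ∣
      ≡⟨ ∣p*q∣≡∣p∣*∣q∣ (b - a) (r * s) ⟩
    ∣ b - a ∣ * ∣ r * s ∣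
      ≡⟨ cong (∣ b - a ∣ *_) (0≤p⇒∣p∣≡p 0≤rs) ⟩
    ∣ b - a ∣ * (r * s)
      ≤⟨ *-monoʳ-≤-nonNeg (r * s) {{nonNegative 0≤rs}} b-a≤ ⟩
    (ε * (δ * δ)) * (r * s)
      ≡⟨ solve 4 (λ e d r s → (e :* (d :* d)) :* (r :* s) := e :* ((d :* r) :* (d :* s)))
           refl ε δ r s ⟩
    ε * ((δ * r) * (δ * s))
      ≤⟨ *-monoˡ-≤-nonNeg ε {{nonNegative 0≤ε}}
           (*-mono-≤-nonNeg (0≤* 0≤δ 0≤r) (<⇒≤ (positive⁻¹ 1ℚ))
             (δ*≤1 0≤r ar≡1 δ≤a) (δ*≤1 0≤s bs≡1 δ≤b)) ⟩
    ε * (1ℚ * 1ℚ)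
      ≡⟨ *-identityʳ ε ⟩
    ε ∎
    where
    open +-*-Solver
    0≤* : ∀ {p q} → 0ℚ ≤ p → 0ℚ ≤ q → 0ℚ ≤ p * q
    0≤* {p} {q} 0≤p 0≤q = subst (_≤ p * q) (*-zeroʳ p) (*-monoˡ-≤-nonNeg p {{nonNegative 0≤p}} 0≤q)
    0≤rs : 0ℚ ≤ r * s
    0≤rs = 0≤* 0≤r 0≤s
    δ*≤1 : ∀ {a r} → 0ℚ ≤ r → a * r ≡ 1ℚ → δ ≤ a → δ * r ≤ 1ℚ
    δ*≤1 {a} {r} 0≤r ar≡1 δ≤a =
      ≤-trans (*-monoʳ-≤-nonNeg r {{nonNegative 0≤r}} δ≤a) (≤-reflexive ar≡1)

  recip-cauchy : ∀ {x} → IsCauchy x →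
    ∃[ δ ] 0ℚ < δ × ∃[ N ] (∀ n → N ℕ.≤ n → 0ℚ + δ ≤ x n) →
    IsCauchy (λ n → recip (x n))
  recip-cauchy {x} cx (δ , 0<δ , M , hδ) ε 0<ε
    with cx (ε * (δ * δ)) (*-pos 0<ε (*-pos 0<δ 0<δ))
  ... | N , h = M ℕ.⊔ N , λ m n p q →
    let p₁ = ℕ.m⊔n≤o⇒m≤o M N p ; p₂ = ℕ.m⊔n≤o⇒n≤o M N p
        q₁ = ℕ.m⊔n≤o⇒m≤o M N q ; q₂ = ℕ.m⊔n≤o⇒n≤o M N q
    in recip-close (x m) (x n) (recip (x m)) (recip (x n))
         (*-recip (x>0 p₁)) (*-recip (x>0 q₁))
         (<⇒≤ (recip-pos (x>0 p₁))) (<⇒≤ (recip-pos (x>0 q₁)))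
         (<⇒≤ 0<δ) (<⇒≤ 0<ε) (δ≤ p₁) (δ≤ q₁) (h n m q₂ p₂)
    where
    δ≤ : ∀ {n} → M ℕ.≤ n → δ ≤ x n
    δ≤ {n} p = subst (_≤ x n) (+-identityˡ δ) (hδ n p)
    x>0 : ∀ {n} → M ℕ.≤ n → 0ℚ < x n
    x>0 p = <-≤-trans 0<δ (δ≤ p)

  1/! : ℕ → ℚ
  1/! n = (+ 1 / n !) {{ℕ._!≢0 n}}

  eSeq : ℕ → ℚ
  eSeq zero    = 1/! 0
  eSeq (suc n) = eSeq n + 1/! (suc n)

  1/-antitone : ∀ m n .{{_ : NonZero m}} .{{_ : NonZero n}} →
                m ℕ.≤ n → + 1 / n ≤ + 1 / m
  1/-antitone (suc m) (suc n) m≤n = toℚᵘ-cancel-≤ (ℚᵘ.≤-respˡ-≃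
    (ℚᵘ.≃-sym (toℚᵘ-fromℚᵘ (ℚᵘ.mkℚᵘ (+ 1) n)))
    (ℚᵘ.≤-respʳ-≃ (ℚᵘ.≃-sym (toℚᵘ-fromℚᵘ (ℚᵘ.mkℚᵘ (+ 1) m)))
      (ℚᵘ.*≤* (ℤ.*-monoˡ-≤-nonNeg (+ 1) (ℤ.+≤+ m≤n)))))

  double-1/ : ∀ n .{{_ : NonZero n}} .{{_ : NonZero (2 ℕ.* n)}} →
              + 1 / (2 ℕ.* n) + + 1 / (2 ℕ.* n) ≡ + 1 / n
  double-1/ n@(suc k) = toℚᵘ-injective (ℚᵘ.≃-trans
    (toℚᵘ-homo-+ (+ 1 / (2 ℕ.* n)) (+ 1 / (2 ℕ.* n)))
    (ℚᵘ.≃-trans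
      (ℚᵘ.+-cong (toℚᵘ-fromℚᵘ h) (toℚᵘ-fromℚᵘ h))
      (ℚᵘ.≃-trans half+half
        (ℚᵘ.≃-sym (toℚᵘ-fromℚᵘ (ℚᵘ.mkℚᵘ (+ 1) k))))))
    where
    h : ℚᵘ.ℚᵘ
    h = ℚᵘ.mkℚᵘ (+ 1) (ℕ.pred (2 ℕ.* n))
    half+half : h ℚᵘ.+ h ℚᵘ.≃ ℚᵘ.mkℚᵘ (+ 1) k
    half+half = ℚᵘ.*≡* (cong +_ (nat n))
      where
      open import Data.Nat.Solver using () renaming (module +-*-Solver to ℕ-Solver)
      open ℕ-Solver
      nat : ∀ n → (1 ℕ.* (2 ℕ.* n) ℕ.+ 1 ℕ.* (2 ℕ.* n)) ℕ.* n ≡ 1 ℕ.* ((2 ℕ.* n) ℕ.* (2 ℕ.* n))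
      nat = solve 1 (λ n → (con 1 :* (con 2 :* n) :+ con 1 :* (con 2 :* n)) :* n
                            := con 1 :* ((con 2 :* n) :* (con 2 :* n))) refl

  0<1/! : ∀ n → 0ℚ < 1/! n
  0<1/! n = positive⁻¹ (1/! n) {{normalize-pos 1 (n !) {{ℕ._!≢0 n}}}}

  1/!-double : ∀ n → 1 ℕ.≤ n → 1/! (suc n) + 1/! (suc n) ≤ 1/! n
  1/!-double n 1≤n = ≤-trans (+-mono-≤ le le) (≤-reflexive (double-1/ (n !)))
    where
    instance
      _ = ℕ._!≢0 n
      _ = ℕ._!≢0 (suc n)
      _ = ℕ.m*n≢0 2 (n !)
    le : 1/! (suc n) ≤ + 1 / (2 ℕ.* n !)
    le = 1/-antitone (2 ℕ.* n !) (suc n !) (ℕ.*-monoˡ-≤ (n !) (ℕ.s≤s 1≤n))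

  eSeq-mono : ∀ m k → eSeq m ≤ eSeq (k ℕ.+ m)
  eSeq-mono m zero    = ≤-refl
  eSeq-mono m (suc k) = ≤-trans (eSeq-mono m k)
    (subst (_≤ eSeq (suc k ℕ.+ m)) (+-identityʳ (eSeq (k ℕ.+ m)))
      (+-monoʳ-≤ (eSeq (k ℕ.+ m)) (<⇒≤ (0<1/! (suc k ℕ.+ m)))))

  eSeq-upper : ∀ m k → 1 ℕ.≤ m → eSeq (k ℕ.+ m) + 1/! (k ℕ.+ m) ≤ eSeq m + 1/! m
  eSeq-upper m zero    1≤m = ≤-refl
  eSeq-upper m (suc k) 1≤m = begin
    (eSeq n + 1/! (suc n)) + 1/! (suc n)   ≡⟨ +-assoc (eSeq n) (1/! (suc n)) (1/! (suc n)) ⟩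
    eSeq n + (1/! (suc n) + 1/! (suc n))   ≤⟨ +-monoʳ-≤ (eSeq n) (1/!-double n (ℕ.m≤n⇒m≤o+n k 1≤m)) ⟩
    eSeq n + 1/! n                         ≤⟨ eSeq-upper m k 1≤m ⟩
    eSeq m + 1/! m                         ∎
    where n = k ℕ.+ m

  n≤n! : ∀ n → n ℕ.≤ n !
  n≤n! zero    = ℕ.z≤n
  n≤n! (suc n) = ℕ.m≤m*n (suc n) (n !) {{ℕ._!≢0 n}}

  archimedean : ∀ ε → 0ℚ < ε → ∃[ N ] 1/! (suc N) ≤ ε
  archimedean ε@(mkℚ (+ suc a) d-1 _) 0<ε = d-1 , ≤-trans
    (1/-antitone (suc d-1) (suc d-1 !) {{_}} {{ℕ._!≢0 (suc d-1)}} (n≤n! (suc d-1)))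
    (toℚᵘ-cancel-≤ (ℚᵘ.≤-respˡ-≃ (ℚᵘ.≃-sym (toℚᵘ-fromℚᵘ (ℚᵘ.mkℚᵘ (+ 1) d-1)))
      (ℚᵘ.*≤* (ℤ.*-monoʳ-≤-nonNeg (+ suc d-1) {+ 1} {+ suc a} (ℤ.+≤+ (ℕ.s≤s ℕ.z≤n))))))
  archimedean (mkℚ (+ zero) _ _) (ℚ.*<* (ℤ.+<+ ()))
  archimedean (mkℚ (ℤ.-[1+ _ ]) _ _) (ℚ.*<* ())

  e-cauchy : IsCauchy eSeq
  e-cauchy ε 0<ε with archimedean ε 0<ε
  ... | N , h = suc N , λ m n p q →
    ≤⇒close (≤-trans (upper m p) (+-monoˡ-≤ ε (lower n q)))
            (≤-trans (upper n q) (+-monoˡ-≤ ε (lower m p)))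
    where
    lower : ∀ n → suc N ℕ.≤ n → eSeq (suc N) ≤ eSeq n
    lower n p = subst (λ k → eSeq (suc N) ≤ eSeq k) (ℕ.m∸n+n≡m p)
                      (eSeq-mono (suc N) (n ℕ.∸ suc N))
    upper : ∀ n → suc N ℕ.≤ n → eSeq n ≤ eSeq (suc N) + ε
    upper n p = begin
      eSeq n                        ≡⟨ +-identityʳ (eSeq n) ⟨
      eSeq n + 0ℚ                   ≤⟨ +-monoʳ-≤ (eSeq n) (<⇒≤ (0<1/! n)) ⟩
      eSeq n + 1/! n                ≤⟨ subst (λ k → eSeq k + 1/! k ≤ eSeq (suc N) + 1/! (suc N))
                                         (ℕ.m∸n+n≡m p)
                                         (eSeq-upper (suc N) (n ℕ.∸ suc N) (ℕ.s≤s ℕ.z≤n)) ⟩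
      eSeq (suc N) + 1/! (suc N)    ≤⟨ +-monoʳ-≤ (eSeq (suc N)) h ⟩
      eSeq (suc N) + ε              ∎

record ℝ : Set where
  constructor mkℝ
  field
    seq    : ℕ → ℚ
    cauchy : IsCauchy seq

open ℝ public

infix 4 _≤_ _<_ _≃_

_≤_ : ℝ → ℝ → Set
x ≤ y = ∀ ε → 0ℚ ℚ.< ε → ∃[ N ] (∀ n → N ℕ.≤ n → seq x n ℚ.≤ seq y n ℚ.+ ε)

_<_ : ℝ → ℝ → Set
x < y = ∃[ δ ] 0ℚ ℚ.< δ × ∃[ N ] (∀ n → N ℕ.≤ n → seq x n ℚ.+ δ ℚ.≤ seq y n)

_≃_ : ℝ → ℝ → Set
x ≃ y = x ≤ y × y ≤ x

infixl 7 _*_ _/_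
infixl 6 _+_ _-_ _⊔_

fromℚ : ℚ → ℝ
fromℚ q = mkℝ (λ _ → q) (const-cauchy q)

0ℝ 1ℝ : ℝ
0ℝ = fromℚ 0ℚ
1ℝ = fromℚ 1ℚ

_+_ _-_ _*_ _⊔_ : ℝ → ℝ → ℝ
x + y = mkℝ (λ n → seq x n ℚ.+ seq y n) (+-cauchy {seq x} {seq y} (cauchy x) (cauchy y))
x - y = x + mkℝ (λ n → ℚ.- seq y n) (neg-cauchy {seq y} (cauchy y))
x * y = mkℝ (λ n → seq x n ℚ.* seq y n) (*-cauchy {seq x} {seq y} (cauchy x) (cauchy y))
x ⊔ y = mkℝ (λ n → seq x n ℚ.⊔ seq y n) (⊔-cauchy {seq x} {seq y} (cauchy x) (cauchy y))

_/_ : ℝ → (d : ℕ) → .{{NonZero d}} → ℝ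
x / d = x * fromℚ (+ 1 ℚ./ d)

inverse : (x : ℝ) → 0ℝ < x → ℝ
inverse x 0<x = mkℝ (λ n → recip (seq x n)) (recip-cauchy {seq x} (cauchy x) 0<x)

e : ℝ
e = mkℝ eSeq e-cauchy

0<e : 0ℝ < e
0<e = 1ℚ , ℚ.positive⁻¹ 1ℚ , 0 , λ n _ →
  subst (1ℚ ℚ.≤_) (cong eSeq (ℕ.+-identityʳ n)) (eSeq-mono 0 n)

[e-1]/e : ℝ
[e-1]/e = (e - 1ℝ) * inverse e 0<e

∑ : ∀ {n} → Subset n → (Fin n → ℝ) → ℝ
∑ []          f = 0ℝ
∑ (true  ∷ S) f = f zero + ∑ S (λ i → f (suc i))
∑ (false ∷ S) f = ∑ S (λ i → f (suc i))

syntax ∑ S (λ i → t) = ∑[ i ∈ S ] t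

-- L = Fin m is the offline side, R = Fin n the online side.
record BipartiteGraph (m n : ℕ) : Set where
  field
    nbr : Fin n → Subset m

  nbrᴸ : Fin m → Subset n
  nbrᴸ i = tabulate (λ j → lookup (nbr j) i)

  degree : Fin n → ℕ
  degree j = Subset.∣ nbr j ∣

open BipartiteGraph public

module _ {m n : ℕ} (G : BipartiteGraph m n) where

  -- Values x i j with i ∉ nbr G j are never looked at.
  Allocation : Set
  Allocation = Fin m → Fin n → ℝ

  value : Allocation → ℝ
  value x = ∑[ j ∈ ⊤ ] (∑[ i ∈ nbr G j ] x i j)

  record IsFractionalMatching (x : Allocation) : Set where
    field
      nonneg  : ∀ i j → i ∈ nbr G j → 0ℝ ≤ x i j
      offline : ∀ i → (∑[ j ∈ nbrᴸ G i ] x i j) ≤ 1ℝ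
      online  : ∀ j → (∑[ i ∈ nbr G j ] x i j) ≤ 1ℝ

  IsOPT : ℝ → Set
  IsOPT v = (∃[ z ] IsFractionalMatching z × value z ≃ v)
          × (∀ z → IsFractionalMatching z → value z ≤ v)

IsLargest : (ℝ → Set) → ℝ → Set
IsLargest P ℓ = P ℓ × (∀ ℓ′ → P ℓ′ → ℓ′ ≤ ℓ)

-- The online vertex j arrives at time π ⟨$⟩ʳ j.
ArrivalOrder : ℕ → Set
ArrivalOrder = Permutation′

arrivedBefore : ∀ {n} → ArrivalOrder n → Fin n → Subset n
arrivedBefore π j = tabulate (λ j′ → does (π ⟨$⟩ʳ j′ Fin.<? π ⟨$⟩ʳ j))

module _ {m n : ℕ} (G : BipartiteGraph m n) (π : ArrivalOrder n) where

  waterLevel : Allocation G → Fin m → Fin n → ℝ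
  waterLevel x i j = ∑[ j′ ∈ nbrᴸ G i ∩ arrivedBefore π j ] x i j′

  Fillable : Allocation G → Fin n → ℝ → Set
  Fillable x j ℓ = 0ℝ ≤ ℓ × ℓ ≤ 1ℝ
                 × (∑[ i ∈ nbr G j ] (0ℝ ⊔ (ℓ - waterLevel x i j))) ≤ 1ℝ

  -- The closed form of continuous filling: ℓ is the common level to which the
  -- lowest neighbours of j are raised.  Since waterLevel x i j only involves
  -- vertices arriving before j, this determines x on the edges (up to ≃) by
  -- recursion along π.
  IsWaterFilling : Allocation G → Set
  IsWaterFilling x = ∀ j → ∃[ ℓ ] IsLargest (Fillable x j) ℓ
    × (∀ i → i ∈ nbr G j → x i j ≃ 0ℝ ⊔ (ℓ - waterLevel x i j))

{-# OPTIONS --safe #-}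

-- The proof is primal-dual.  For a convex potential G with G 0 = 0 and derivative
-- g ≤ 1, give the offline vertex i with final water level Yᵢ the dual value
-- αᵢ = G Yᵢ, and give the online vertex j what remains of the water it brings,
-- βⱼ = ∑ᵢ (xᵢⱼ - (G (yᵢ + xᵢⱼ) - G yᵢ)).  These values sum to the value of the
-- allocation, so by weak duality it suffices that αᵢ + βⱼ ≥ ρ on every edge.
-- Let ℓ be the level at which j stops, so that Yᵢ ≥ ℓ.  If ℓ = 1, then αᵢ ≥ G 1.
-- Otherwise j is fully matched; then βⱼ ≥ 1 - g ℓ + κ ∑ᵢ xᵢⱼ² by strong convexity
-- of G, and the sum of squares is at least 1/d because j has at most d neighbours.
-- The choice G t = e^(t-1) - 1/e makes both bounds equal to 1 - 1/e up to the
-- gain κ/d.  Mixing in a linear term, g t = (1 - s) e^(t-1) + s with s = 1/(16 d),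
-- passes part of that gain on to the case ℓ = 1.  The exponential is replaced by
-- its Taylor polynomial, with an error that the remaining slack absorbs.
module Submission where

import Algebra.Properties.Semiring.Exp as Exponentiation
open import Algebra.Bundles using (CommutativeRing)
import Algebra.Solver.Ring as RingSolver
open import Algebra.Solver.Ring.AlmostCommutativeRing
  using (fromCommutativeRing; _-Raw-AlmostCommutative⟶_)
open import Algebra.Structures using (IsCommutativeRing)
open import Data.Bool.Base using (Bool; true; false; _∧_; if_then_else_)
open import Data.Bool.Properties using (∧-identityʳ; ∧-zeroʳ)
open import Data.Fin.Base using (Fin; zero; suc; toℕ; fromℕ<)
open import Data.Fin.Permutation using (_⟨$⟩ʳ_; _⟨$⟩ˡ_; inverseʳ; inverseˡ)
import Data.Fin.Properties as Fin
open import Data.Fin.Subset using (Subset; _∈_; _∩_; ⊤)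
import Data.Fin.Subset as Subset
open import Data.Fin.Subset.Properties using (x∈p∩q⁻)
open import Data.Integer.Base using (+_)
import Data.Integer.Base as ℤ
import Data.Integer.Properties as ℤ
open import Data.Maybe.Base using (Maybe; just; nothing)
open import Data.Nat.Base using (ℕ; zero; suc; NonZero; _!)
import Data.Nat.Base as ℕ
import Data.Nat.Properties as ℕ
open import Data.Product.Base using (∃-syntax; _×_; _,_; proj₁; proj₂; swap; map₂)
open import Data.Rational.Base using (ℚ; 0ℚ; 1ℚ; ½)
import Data.Rational.Base as ℚ
import Data.Rational.Properties as ℚ
import Data.Rational.Solver as ℚ
import Data.Rational.Unnormalised.Base as ℚᵘ
import Data.Rational.Unnormalised.Properties as ℚᵘ
open import Data.Sum.Base using (_⊎_; inj₁; inj₂; [_,_]′)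
open import Data.Vec.Base using ([]; _∷_; here; there; tabulate; lookup)
open import Data.Vec.Properties
  using (lookup⇒[]=; []=⇒lookup; lookup∘tabulate; lookup-zipWith; tabulate∘lookup; tabulate-cong)
open import Function.Base using (_∘_; id)
open import Function.Bundles using (mk⇔)
open import Level using (0ℓ)
open import Relation.Binary.Bundles using (Poset)
open import Relation.Binary.PropositionalEquality
  using (_≡_; refl; cong; cong₂; subst; module ≡-Reasoning)
import Relation.Binary.PropositionalEquality as ≡
import Relation.Binary.Reasoning.PartialOrder as PosetReasoning
open import Relation.Binary.Structures using (IsPartialOrder)
open import Relation.Nullary.Decidable using (Dec; yes; no; does; dec-true; dec-false; does-⇔)
open import Relation.Nullary.Negation using (¬_; contradiction)

open import Defs using
  ( BipartiteGraph; nbr; nbrᴸ; degree; ArrivalOrder; arrivedBefore; recip; *-recip; recip-pos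
  ; *-pos; 1/!; 0<1/!; 1/!-double; eSeq; eSeq-mono; eSeq-upper; archimedean )

-- The bound `G a + (1 - g a)` of the saturated case should be the same at every stopping level `a`.
-- Asking that G minus its derivative be constant leads to the exponential. Truncating the series
-- preserves this up to one monomial of the right sign, since `exp (1 + n)` is the derivative of
-- `exp (2 + n)`. The number e itself never enters the potential: a rational `μ ≤ 1/e` replaces 1/e,
-- so `1 - μ` is at least `1 - 1/e` and the bound obtained is the stronger one. The order of
-- constructive reals is undecidable, whereas the argument splits on whether a neighbour lies below
-- the level and on whether `j` is fully matched. Such splits are admissible when the goal is an
-- inequality, because `≤` on `ℝ` is stable under double negation; each dichotomy is therefore
-- stated as an eliminator into inequalities. For the same reason the largest level is given by an
-- explicit formula instead of as a supremum.

-- Rational estimates for factorials, reciprocals and e.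

fromℕ : ℕ → ℚ
fromℕ n = + n ℚ./ 1

toℚᵘ-/ : ∀ a n .{{_ : NonZero n}} → ℚ.toℚᵘ (a ℚ./ n) ℚᵘ.≃ a ℚᵘ./ n
toℚᵘ-/ a (suc n) = ℚ.toℚᵘ-fromℚᵘ (ℚᵘ.mkℚᵘ a n)

fromℕ-suc : ∀ n → fromℕ (suc n) ≡ 1ℚ ℚ.+ fromℕ n
fromℕ-suc n = ℚ.toℚᵘ-injective (ℚᵘ.≃-trans (toℚᵘ-/ (+ suc n) 1)
  (ℚᵘ.≃-trans (ℚᵘ.*≡* (cong (λ k → (+ 1 ℤ.+ k) ℤ.* + 1) (≡.sym (ℤ.*-identityʳ (+ n)))))
    (ℚᵘ.≃-sym (ℚᵘ.≃-trans (ℚ.toℚᵘ-homo-+ 1ℚ (fromℕ n)) (ℚᵘ.+-congʳ ℚᵘ.1ℚᵘ (toℚᵘ-/ (+ n) 1))))))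

fromℕ-mono-≤ : ∀ {m n} → m ℕ.≤ n → fromℕ m ℚ.≤ fromℕ n
fromℕ-mono-≤ {m} {n} m≤n = ℚ.toℚᵘ-cancel-≤ (ℚᵘ.≤-respˡ-≃ (ℚᵘ.≃-sym (toℚᵘ-/ (+ m) 1))
  (ℚᵘ.≤-respʳ-≃ (ℚᵘ.≃-sym (toℚᵘ-/ (+ n) 1)) (ℚᵘ.*≤* (ℤ.*-monoʳ-≤-nonNeg (+ 1) (ℤ.+≤+ m≤n)))))

fromℕ-*-/ : ∀ m n .{{_ : NonZero n}} .{{_ : NonZero (m ℕ.* n)}} →
  fromℕ m ℚ.* (+ 1 ℚ./ (m ℕ.* n)) ≡ + 1 ℚ./ n
fromℕ-*-/ m n = ℚ.toℚᵘ-injective (ℚᵘ.≃-trans (ℚ.toℚᵘ-homo-* (fromℕ m) _)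
  (ℚᵘ.≃-trans (ℚᵘ.*-cong (toℚᵘ-/ (+ m) 1) (toℚᵘ-/ (+ 1) (m ℕ.* n)))
    (ℚᵘ.≃-trans (cross m n) (ℚᵘ.≃-sym (toℚᵘ-/ (+ 1) n)))))
  where
  cross : ∀ m n .{{_ : NonZero n}} .{{_ : NonZero (m ℕ.* n)}} →
    (+ m ℚᵘ./ 1) ℚᵘ.* (+ 1 ℚᵘ./ (m ℕ.* n)) ℚᵘ.≃ + 1 ℚᵘ./ n
  cross (suc m) (suc n) = ℚᵘ.*≡* (cong +_ (≡.trans
    (cong (ℕ._* suc n) (ℕ.*-identityʳ (suc m)))
    (≡.sym (≡.trans (ℕ.*-identityˡ _) (ℕ.*-identityˡ _)))))

fromℕ-*-1/ : ∀ n .{{_ : NonZero n}} → fromℕ n ℚ.* (+ 1 ℚ./ n) ≡ 1ℚ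
fromℕ-*-1/ n@(suc k) = ≡.trans
  (cong (fromℕ n ℚ.*_) (ℚ./-cong {+ 1} {n} {+ 1} {n ℕ.* 1} refl (≡.sym (ℕ.*-identityʳ n))))
  (fromℕ-*-/ n 1)

1/!-suc : ∀ n → 1/! (suc n) ℚ.* fromℕ (suc n) ≡ 1/! n
1/!-suc n = ≡.trans (ℚ.*-comm (1/! (suc n)) _)
  (fromℕ-*-/ (suc n) (n !) {{n ℕ.!≢0}} {{suc n ℕ.!≢0}})

recip-antitone : ∀ {a b} → 0ℚ ℚ.< a → a ℚ.≤ b → recip b ℚ.≤ recip a
recip-antitone {a} {b} 0<a a≤b = begin
  recip b                            ≡⟨ ℚ.*-identityʳ _ ⟨
  recip b ℚ.* 1ℚ                     ≡⟨ cong (recip b ℚ.*_) (*-recip 0<a) ⟨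
  recip b ℚ.* (a ℚ.* recip a)        ≤⟨ ℚ.*-monoˡ-≤-nonNeg (recip b) {{ℚ.nonNegative (ℚ.<⇒≤ (recip-pos 0<b))}}
                                          (ℚ.*-monoʳ-≤-nonNeg (recip a) {{ℚ.nonNegative (ℚ.<⇒≤ (recip-pos 0<a))}} a≤b) ⟩
  recip b ℚ.* (b ℚ.* recip a)        ≡⟨ ℚ.*-assoc (recip b) b (recip a) ⟨
  recip b ℚ.* b ℚ.* recip a          ≡⟨ cong (ℚ._* recip a) (≡.trans (ℚ.*-comm _ b) (*-recip 0<b)) ⟩
  1ℚ ℚ.* recip a                     ≡⟨ ℚ.*-identityˡ _ ⟩
  recip a                            ∎
  where
  open ℚ.≤-Reasoning
  0<b = ℚ.<-≤-trans 0<a a≤b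

-- From index 1 on, each term of the series is at least twice the next, so the tail beyond `1/! n`
-- is at most `1/! n`: an upper bound for e that decreases from 3. At index 0 it equals 2, too
-- small, which is why it bounds e at successors only.
eUpper : ℕ → ℚ
eUpper n = eSeq n ℚ.+ 1/! n

eSeq≤eUpper : ∀ n → eSeq n ℚ.≤ eUpper n
eSeq≤eUpper n = subst (ℚ._≤ eUpper n) (ℚ.+-identityʳ (eSeq n)) (ℚ.+-monoʳ-≤ (eSeq n) (ℚ.<⇒≤ (0<1/! n)))

0<eSeq : ∀ n → 0ℚ ℚ.< eSeq n
0<eSeq n = ℚ.<-≤-trans (ℚ.positive⁻¹ 1ℚ)
  (subst (λ k → 1ℚ ℚ.≤ eSeq k) (ℕ.+-identityʳ n) (eSeq-mono 0 n))

0<eUpper : ∀ n → 0ℚ ℚ.< eUpper n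
0<eUpper n = ℚ.<-≤-trans (0<eSeq n) (eSeq≤eUpper n)

eUpper≤3 : ∀ n → eUpper (suc n) ℚ.≤ fromℕ 3
eUpper≤3 n = subst (λ k → eUpper k ℚ.≤ fromℕ 3) (ℕ.+-comm n 1) (eSeq-upper 1 n ℕ.≤-refl)

1/!-suc-≤ : ∀ n → 1/! (2 ℕ.+ n) ℚ.≤ 1/! (1 ℕ.+ n)
1/!-suc-≤ n = ℚ.≤-trans
  (subst (ℚ._≤ 1/! (2 ℕ.+ n) ℚ.+ 1/! (2 ℕ.+ n)) (ℚ.+-identityʳ _)
    (ℚ.+-monoʳ-≤ (1/! (2 ℕ.+ n)) (ℚ.<⇒≤ (0<1/! (2 ℕ.+ n)))))
  (1/!-double (suc n) (ℕ.s≤s ℕ.z≤n))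

-- Ordered algebras: inequalities and finite sums.

-- An ordered commutative ℚ-algebra with just enough classical logic
-- (≤-cases) for case distinctions on the order when an inequality is proved.
-- Its 0 and 1 are ι 0ℚ and ι 1ℚ, so that the ring solver can take its
-- coefficients in ℚ.
record OrderedAlgebra : Set₁ where
  infix  4 _≈_ _≤_
  infixl 6 _+_ _⊔_
  infixl 7 _*_
  infix  8 -_
  field
    Carrier : Set
    _≈_ _≤_ : Carrier → Carrier → Set
    _+_ _*_ _⊔_ : Carrier → Carrier → Carrier
    -_ : Carrier → Carrier
    ι : ℚ → Carrier
    isCommutativeRing : IsCommutativeRing _≈_ _+_ _*_ -_ (ι 0ℚ) (ι 1ℚ)
    isPartialOrder : IsPartialOrder _≈_ _≤_
    ι-+ : ∀ p q → ι (p ℚ.+ q) ≈ ι p + ι q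
    ι-* : ∀ p q → ι (p ℚ.* q) ≈ ι p * ι q
    ι-neg : ∀ p → ι (ℚ.- p) ≈ - ι p
    ι-mono : ∀ {p q} → p ℚ.≤ q → ι p ≤ ι q
    +-monoʳ-≤ : ∀ z {x y} → x ≤ y → z + x ≤ z + y
    0≤* : ∀ {x y} → ι 0ℚ ≤ x → ι 0ℚ ≤ y → ι 0ℚ ≤ x * y
    x≤x⊔y : ∀ x y → x ≤ x ⊔ y
    y≤x⊔y : ∀ x y → y ≤ x ⊔ y
    ⊔-lub : ∀ {x y z} → x ≤ z → y ≤ z → x ⊔ y ≤ z
    ≤-cases : ∀ x y {a b} → (x ≤ y → a ≤ b) → (y ≤ x → a ≤ b) → a ≤ b
    ∑ : ∀ {n} → Subset n → (Fin n → Carrier) → Carrier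
    ∑-[] : ∀ f → ∑ [] f ≈ ι 0ℚ
    ∑-true : ∀ {n} (S : Subset n) f → ∑ (true ∷ S) f ≈ f zero + ∑ S (f ∘ suc)
    ∑-false : ∀ {n} (S : Subset n) f → ∑ (false ∷ S) f ≈ ∑ S (f ∘ suc)

module OrderedAlgebraProperties (𝔸 : OrderedAlgebra) where
  open OrderedAlgebra 𝔸 public

  commutativeRing : CommutativeRing 0ℓ 0ℓ
  commutativeRing = record { isCommutativeRing = isCommutativeRing }

  open CommutativeRing commutativeRing public
    using (0#; 1#; _-_; +-cong; +-congˡ; +-congʳ; *-cong; *-congˡ; *-congʳ; -‿cong;
           +-identityʳ; +-identityˡ; *-identityʳ; *-identityˡ; +-comm; *-comm; +-assoc;
           zeroˡ; zeroʳ; distribˡ)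
    renaming (refl to ≈-refl; sym to ≈-sym; trans to ≈-trans; reflexive to ≈-reflexive)

  poset : Poset 0ℓ 0ℓ 0ℓ
  poset = record { isPartialOrder = isPartialOrder }

  open Poset poset public using ()
    renaming (refl to ≤-refl; trans to ≤-trans; antisym to ≤-antisym; reflexive to ≤-reflexive)

  ι-homomorphism : ℚ.+-*-rawRing -Raw-AlmostCommutative⟶ fromCommutativeRing commutativeRing
  ι-homomorphism = record
    { ⟦_⟧ = ι
    ; +-homo = ι-+
    ; *-homo = ι-*
    ; -‿homo = ι-neg
    ; 0-homo = ≈-refl
    ; 1-homo = ≈-refl
    }

  ι-cong? : ∀ p q → Maybe (ι p ≈ ι q)
  ι-cong? p q with p ℚ.≟ q
  ... | yes p≡q = just (≈-reflexive (cong ι p≡q))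
  ... | no _ = nothing

  module Solver = RingSolver ℚ.+-*-rawRing (fromCommutativeRing commutativeRing) ι-homomorphism ι-cong?
  open Solver public using (solve; _:=_; _:+_; _:*_; _:-_; :-_; con)

  module ≤-Reasoning = PosetReasoning poset

  sub-≥0 : ∀ {x y} → x ≤ y → 0# ≤ y - x
  sub-≥0 {x} {y} x≤y = begin
    0#        ≈⟨ solve 1 (λ x → con 0ℚ := :- x :+ x) ≈-refl x ⟩
    - x + x   ≤⟨ +-monoʳ-≤ (- x) x≤y ⟩
    - x + y   ≈⟨ +-comm (- x) y ⟩
    y - x     ∎
    where open ≤-Reasoning

  -- An inequality is proved by exhibiting the difference as a sum of products
  -- of nonnegative terms.
  by-difference : ∀ {x y t} → 0# ≤ t → y ≈ x + t → x ≤ y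
  by-difference {x} {y} {t} 0≤t y≈x+t = begin
    x        ≈⟨ +-identityʳ x ⟨
    x + 0#   ≤⟨ +-monoʳ-≤ x 0≤t ⟩
    x + t    ≈⟨ y≈x+t ⟨
    y        ∎
    where open ≤-Reasoning

  0≤+ : ∀ {x y} → 0# ≤ x → 0# ≤ y → 0# ≤ x + y
  0≤+ {x} {y} 0≤x 0≤y = ≤-trans 0≤x (by-difference 0≤y ≈-refl)

  0≤ι : ∀ {p} → 0ℚ ℚ.≤ p → 0# ≤ ι p
  0≤ι = ι-mono

  0≤1# : 0# ≤ 1#
  0≤1# = 0≤ι (ℚ.nonNegative⁻¹ 1ℚ)

  ι-fromℕ-suc : ∀ k → ι (fromℕ (suc k)) ≈ 1# + ι (fromℕ k)
  ι-fromℕ-suc k = ≈-trans (≈-reflexive (cong ι (fromℕ-suc k))) (ι-+ _ _)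

  ι-fromℕ-*-1/ : ∀ k → ι (fromℕ (suc k)) * ι (+ 1 ℚ./ suc k) ≈ 1#
  ι-fromℕ-*-1/ k = ≈-trans (≈-sym (ι-* _ _)) (≈-reflexive (cong ι (fromℕ-*-1/ (suc k))))

  0≤ι-fromℕ : ∀ k → 0# ≤ ι (fromℕ k)
  0≤ι-fromℕ k = 0≤ι (ℚ.nonNegative⁻¹ (fromℕ k) {{ℚ.normalize-nonNeg k 1}})

  0≤ι-1/ : ∀ k → 0# ≤ ι (+ 1 ℚ./ suc k)
  0≤ι-1/ k = 0≤ι (ℚ.nonNegative⁻¹ (+ 1 ℚ./ suc k) {{ℚ.normalize-nonNeg 1 (suc k)}})

  +-mono-≤ : ∀ {w x y z} → w ≤ x → y ≤ z → w + y ≤ x + z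
  +-mono-≤ {w} {x} {y} {z} w≤x y≤z = by-difference (0≤+ (sub-≥0 w≤x) (sub-≥0 y≤z))
    (solve 4 (λ w x y z → x :+ z := w :+ y :+ ((x :- w) :+ (z :- y))) ≈-refl w x y z)

  *-monoˡ-≤ : ∀ {x y z} → 0# ≤ z → x ≤ y → z * x ≤ z * y
  *-monoˡ-≤ {x} {y} {z} 0≤z x≤y = by-difference (0≤* 0≤z (sub-≥0 x≤y))
    (solve 3 (λ x y z → z :* y := z :* x :+ z :* (y :- x)) ≈-refl x y z)

  *-mono-≤ : ∀ {w x y z} → 0# ≤ w → 0# ≤ z → w ≤ x → y ≤ z → w * y ≤ x * z
  *-mono-≤ {w} {x} {y} {z} 0≤w 0≤z w≤x y≤z =
    by-difference (0≤+ (0≤* 0≤w (sub-≥0 y≤z)) (0≤* 0≤z (sub-≥0 w≤x)))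
    (solve 4 (λ w x y z → x :* z := w :* y :+ (w :* (z :- y) :+ z :* (x :- w))) ≈-refl w x y z)

  ⊔-cong : ∀ {w x y z} → w ≈ x → y ≈ z → w ⊔ y ≈ x ⊔ z
  ⊔-cong w≈x y≈z = ≤-antisym (⊔-mono w≈x y≈z) (⊔-mono (≈-sym w≈x) (≈-sym y≈z))
    where
    ⊔-mono : ∀ {w x y z} → w ≈ x → y ≈ z → w ⊔ y ≤ x ⊔ z
    ⊔-mono {w} {x} {y} {z} w≈x y≈z = ⊔-lub (≤-trans (≤-reflexive w≈x) (x≤x⊔y x z))
                                           (≤-trans (≤-reflexive y≈z) (y≤x⊔y x z))

  x≤y⇒x⊔y≈y : ∀ {x y} → x ≤ y → x ⊔ y ≈ y
  x≤y⇒x⊔y≈y {x} {y} x≤y = ≤-antisym (⊔-lub x≤y ≤-refl) (y≤x⊔y x y)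

  y≤x⇒x⊔y≈x : ∀ {x y} → y ≤ x → x ⊔ y ≈ x
  y≤x⇒x⊔y≈x {x} {y} y≤x = ≤-antisym (⊔-lub ≤-refl y≤x) (x≤x⊔y x y)

  indicator : Bool → Carrier → Carrier
  indicator b x = if b then x else 0#

  ∑-∷ : ∀ {n} b (S : Subset n) f → ∑ (b ∷ S) f ≈ indicator b (f zero) + ∑ S (f ∘ suc)
  ∑-∷ true S f = ∑-true S f
  ∑-∷ false S f = ≈-trans (∑-false S f) (≈-sym (+-identityˡ _))

  ∑-0 : ∀ {n} (S : Subset n) → ∑ S (λ _ → 0#) ≈ 0#
  ∑-0 [] = ∑-[] _
  ∑-0 (true ∷ S) = ≈-trans (∑-true S _) (≈-trans (+-identityˡ _) (∑-0 S))
  ∑-0 (false ∷ S) = ≈-trans (∑-false S _) (∑-0 S)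

  ∑-+ : ∀ {n} (S : Subset n) f g → ∑ S (λ i → f i + g i) ≈ ∑ S f + ∑ S g
  ∑-+ [] f g = ≈-trans (∑-[] _) (≈-trans (≈-sym (+-identityˡ 0#)) (≈-sym (+-cong (∑-[] f) (∑-[] g))))
  ∑-+ (true ∷ S) f g = begin-equality
    ∑ (true ∷ S) (λ i → f i + g i)
      ≈⟨ ∑-true S _ ⟩
    f zero + g zero + ∑ S (λ i → f (suc i) + g (suc i))
      ≈⟨ +-congˡ (∑-+ S (f ∘ suc) (g ∘ suc)) ⟩
    f zero + g zero + (∑ S (f ∘ suc) + ∑ S (g ∘ suc))
      ≈⟨ solve 4 (λ a b c d → a :+ b :+ (c :+ d) := a :+ c :+ (b :+ d)) ≈-refl _ _ _ _ ⟩
    f zero + ∑ S (f ∘ suc) + (g zero + ∑ S (g ∘ suc))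
      ≈⟨ +-cong (∑-true S f) (∑-true S g) ⟨
    ∑ (true ∷ S) f + ∑ (true ∷ S) g ∎
    where open ≤-Reasoning
  ∑-+ (false ∷ S) f g = begin-equality
    ∑ (false ∷ S) (λ i → f i + g i)
      ≈⟨ ∑-false S _ ⟩
    ∑ S (λ i → f (suc i) + g (suc i))
      ≈⟨ ∑-+ S (f ∘ suc) (g ∘ suc) ⟩
    ∑ S (f ∘ suc) + ∑ S (g ∘ suc)
      ≈⟨ +-cong (∑-false S f) (∑-false S g) ⟨
    ∑ (false ∷ S) f + ∑ (false ∷ S) g ∎
    where open ≤-Reasoning

  ∑-*ˡ : ∀ {n} (S : Subset n) c f → ∑ S (λ i → c * f i) ≈ c * ∑ S f
  ∑-*ˡ [] c f = ≈-trans (∑-[] _) (≈-sym (≈-trans (*-congˡ (∑-[] f)) (zeroʳ c)))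
  ∑-*ˡ (true ∷ S) c f = ≈-trans (∑-true S _) (≈-trans (+-congˡ (∑-*ˡ S c (f ∘ suc)))
    (≈-sym (≈-trans (*-congˡ (∑-true S f)) (distribˡ c _ _))))
  ∑-*ˡ (false ∷ S) c f = ≈-trans (∑-false S _) (≈-trans (∑-*ˡ S c (f ∘ suc))
    (*-congˡ (≈-sym (∑-false S f))))

  ∑-mono-≤ : ∀ {n} (S : Subset n) {f g} → (∀ i → i ∈ S → f i ≤ g i) → ∑ S f ≤ ∑ S g
  ∑-mono-≤ [] f≤g = ≤-reflexive (≈-trans (∑-[] _) (≈-sym (∑-[] _)))
  ∑-mono-≤ (true ∷ S) {f} {g} f≤g = begin
    ∑ (true ∷ S) f           ≈⟨ ∑-true S f ⟩
    f zero + ∑ S (f ∘ suc)   ≤⟨ +-mono-≤ (f≤g zero here) (∑-mono-≤ S (λ i → f≤g (suc i) ∘ there)) ⟩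
    g zero + ∑ S (g ∘ suc)   ≈⟨ ∑-true S g ⟨
    ∑ (true ∷ S) g           ∎
    where open ≤-Reasoning
  ∑-mono-≤ (false ∷ S) {f} {g} f≤g = begin
    ∑ (false ∷ S) f   ≈⟨ ∑-false S f ⟩
    ∑ S (f ∘ suc)     ≤⟨ ∑-mono-≤ S (λ i → f≤g (suc i) ∘ there) ⟩
    ∑ S (g ∘ suc)     ≈⟨ ∑-false S g ⟨
    ∑ (false ∷ S) g   ∎
    where open ≤-Reasoning

  ∑-cong : ∀ {n} (S : Subset n) {f g} → (∀ i → i ∈ S → f i ≈ g i) → ∑ S f ≈ ∑ S g
  ∑-cong S f≈g = ≤-antisym (∑-mono-≤ S (λ i → ≤-reflexive ∘ f≈g i))
                           (∑-mono-≤ S (λ i → ≤-reflexive ∘ ≈-sym ∘ f≈g i))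

  0≤∑ : ∀ {n} (S : Subset n) {f} → (∀ i → i ∈ S → 0# ≤ f i) → 0# ≤ ∑ S f
  0≤∑ S {f} 0≤f = ≤-trans (≤-reflexive (≈-sym (∑-0 S))) (∑-mono-≤ S 0≤f)

  ∑-⊤-indicator : ∀ {n} (S : Subset n) f → ∑ ⊤ (λ i → indicator (lookup S i) (f i)) ≈ ∑ S f
  ∑-⊤-indicator [] f = ≈-trans (∑-[] _) (≈-sym (∑-[] f))
  ∑-⊤-indicator (b ∷ S) f = ≈-trans (∑-true ⊤ _)
    (≈-trans (+-congˡ (∑-⊤-indicator S (f ∘ suc))) (≈-sym (∑-∷ b S f)))

  -- The inner index set on the right has the very form of `nbrᴸ`, so double counting of the edges
  -- applies without conversion.
  ∑-swap : ∀ {m n} (A : Fin n → Subset m) (h : Fin m → Fin n → Carrier) →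
    ∑ ⊤ (λ j → ∑ (A j) (λ i → h i j)) ≈ ∑ ⊤ (λ i → ∑ (tabulate (λ j → lookup (A j) i)) (h i))
  ∑-swap {m} {zero} A h = ≈-trans (∑-[] _) (≈-sym (≈-trans (∑-cong ⊤ (λ i _ → ∑-[] (h i))) (∑-0 {m} ⊤)))
  ∑-swap {m} {suc n} A h = begin-equality
    ∑ ⊤ (λ j → ∑ (A j) (λ i → h i j))
      ≈⟨ ∑-true ⊤ _ ⟩
    ∑ (A zero) (λ i → h i zero) + ∑ ⊤ (λ j → ∑ (A (suc j)) (λ i → h i (suc j)))
      ≈⟨ +-cong (≈-sym (∑-⊤-indicator (A zero) _)) (∑-swap (A ∘ suc) (λ i → h i ∘ suc)) ⟩
    ∑ ⊤ (λ i → indicator (lookup (A zero) i) (h i zero))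
      + ∑ ⊤ (λ i → ∑ (tabulate (λ j → lookup (A (suc j)) i)) (h i ∘ suc))
      ≈⟨ ∑-+ ⊤ _ _ ⟨
    ∑ ⊤ (λ i → indicator (lookup (A zero) i) (h i zero)
      + ∑ (tabulate (λ j → lookup (A (suc j)) i)) (h i ∘ suc))
      ≈⟨ ∑-cong ⊤ (λ i _ → ≈-sym (∑-∷ (lookup (A zero) i) _ (h i))) ⟩
    ∑ ⊤ (λ i → ∑ (tabulate (λ j → lookup (A j) i)) (h i)) ∎
    where open ≤-Reasoning

  ∑-insert : ∀ {n} (S S′ : Subset n) j f → lookup S j ≡ false → lookup S′ j ≡ true →
    (∀ k → ¬ k ≡ j → lookup S k ≡ lookup S′ k) → ∑ S′ f ≈ ∑ S f + f j
  ∑-insert (_ ∷ S) (_ ∷ S′) zero f refl refl agree = begin-equality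
    ∑ (true ∷ S′) f          ≈⟨ ∑-true S′ f ⟩
    f zero + ∑ S′ (f ∘ suc)  ≡⟨ cong (λ T → f zero + ∑ T (f ∘ suc)) S′≡S ⟩
    f zero + ∑ S (f ∘ suc)   ≈⟨ +-comm _ _ ⟩
    ∑ S (f ∘ suc) + f zero   ≈⟨ +-congʳ (∑-false S f) ⟨
    ∑ (false ∷ S) f + f zero ∎
    where
    open ≤-Reasoning
    S′≡S : S′ ≡ S
    S′≡S = ≡.trans (≡.sym (tabulate∘lookup S′))
      (≡.trans (tabulate-cong (λ k → ≡.sym (agree (suc k) (λ ())))) (tabulate∘lookup S))
  ∑-insert (b ∷ S) (b′ ∷ S′) (suc j) f j∉S j∈S′ agree = begin-equality
    ∑ (b′ ∷ S′) f
      ≈⟨ ∑-∷ b′ S′ f ⟩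
    indicator b′ (f zero) + ∑ S′ (f ∘ suc)
      ≈⟨ +-cong (≈-reflexive (cong (λ c → indicator c (f zero)) (≡.sym (agree zero λ ()))))
                (∑-insert S S′ j (f ∘ suc) j∉S j∈S′ (λ k k≢j → agree (suc k) (k≢j ∘ Fin.suc-injective))) ⟩
    indicator b (f zero) + (∑ S (f ∘ suc) + f (suc j))
      ≈⟨ +-assoc _ _ _ ⟨
    indicator b (f zero) + ∑ S (f ∘ suc) + f (suc j)
      ≈⟨ +-congʳ (∑-∷ b S f) ⟨
    ∑ (b ∷ S) f + f (suc j) ∎
    where open ≤-Reasoning

  ∑-⊆ : ∀ {n} (S S′ : Subset n) {f} → (∀ i → i ∈ S → i ∈ S′) → (∀ i → i ∈ S′ → 0# ≤ f i) →
    ∑ S f ≤ ∑ S′ f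
  ∑-⊆ S S′ {f} S⊆S′ 0≤f = begin
    ∑ S f                                    ≈⟨ ∑-⊤-indicator S f ⟨
    ∑ ⊤ (λ i → indicator (lookup S i) (f i)) ≤⟨ ∑-mono-≤ ⊤ (λ i _ → termwise i (lookup S i) (lookup S′ i) refl refl) ⟩
    ∑ ⊤ (λ i → indicator (lookup S′ i) (f i)) ≈⟨ ∑-⊤-indicator S′ f ⟩
    ∑ S′ f ∎
    where
    open ≤-Reasoning
    termwise : ∀ i b b′ → lookup S i ≡ b → lookup S′ i ≡ b′ → indicator b (f i) ≤ indicator b′ (f i)
    termwise i false false _ _ = ≤-refl
    termwise i false true  _ i∈S′ = 0≤f i (lookup⇒[]= i S′ i∈S′)
    termwise i true  true  _ _ = ≤-refl
    termwise i true  false i∈S i∉S′ with () ←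
      ≡.trans (≡.sym i∉S′) ([]=⇒lookup (S⊆S′ i (lookup⇒[]= i S i∈S)))

  ∑-const : ∀ {k} (S : Subset k) c → ∑ S (λ _ → c) ≈ ι (fromℕ Subset.∣ S ∣) * c
  ∑-const [] c = ≈-trans (∑-[] _) (≈-sym (zeroˡ c))
  ∑-const (true ∷ S) c = ≈-trans (∑-true S _) (≈-trans (+-congˡ (∑-const S c))
    (≈-trans (solve 2 (λ k c → c :+ k :* c := (con 1ℚ :+ k) :* c) ≈-refl _ _)
      (*-congʳ (≈-sym (ι-fromℕ-suc Subset.∣ S ∣)))))
  ∑-const (false ∷ S) c = ≈-trans (∑-false S _) (∑-const S c)

  0≤square : ∀ a → 0# ≤ a * a
  0≤square a = ≤-cases 0# a (λ 0≤a → 0≤* 0≤a 0≤a) (λ a≤0 → ≤-trans (0≤* (neg a≤0) (neg a≤0))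
    (≤-reflexive (solve 1 (λ a → (con 0ℚ :- a) :* (con 0ℚ :- a) := a :* a) ≈-refl a)))
    where
    neg : a ≤ 0# → 0# ≤ 0# - a
    neg = sub-≥0

-- The truncated exponential series.

module Taylor (𝔸 : OrderedAlgebra) where
  open OrderedAlgebraProperties 𝔸
  open Exponentiation (CommutativeRing.semiring commutativeRing) using (_^_)

  ^-nonNeg : ∀ {x} k → 0# ≤ x → 0# ≤ x ^ k
  ^-nonNeg zero 0≤x = 0≤1#
  ^-nonNeg (suc k) 0≤x = 0≤* 0≤x (^-nonNeg k 0≤x)

  ^-mono-≤ : ∀ {a b} k → 0# ≤ a → a ≤ b → a ^ k ≤ b ^ k
  ^-mono-≤ zero 0≤a a≤b = ≤-refl
  ^-mono-≤ (suc k) 0≤a a≤b = *-mono-≤ 0≤a (^-nonNeg k (≤-trans 0≤a a≤b)) a≤b (^-mono-≤ k 0≤a a≤b)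

  -- By convexity the secant slope is at most the derivative at the right endpoint. The induction
  -- multiplies the previous bound by `b`; replacing `b * A` by `a * A` then costs `(b - a) * A`, at
  -- most one more copy of `(b - a) * (b * C)`.
  ^-tangent : ∀ {a b} k → 0# ≤ a → a ≤ b →
    b ^ suc k ≤ a ^ suc k + ι (fromℕ (suc k)) * ((b - a) * b ^ k)
  ^-tangent {a} {b} zero 0≤a a≤b = ≤-reflexive
    (solve 2 (λ a b → b :* con 1ℚ := a :* con 1ℚ :+ con 1ℚ :* ((b :- a) :* con 1ℚ)) ≈-refl a b)
  ^-tangent {a} {b} (suc k) 0≤a a≤b = by-difference
    (0≤+ (0≤* (≤-trans 0≤a a≤b) (sub-≥0 (^-tangent k 0≤a a≤b)))
         (0≤* (sub-≥0 a≤b) (sub-≥0 (^-mono-≤ (suc k) 0≤a a≤b))))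
    (begin-equality
      a * A + ι (fromℕ (suc (suc k))) * ((b - a) * (b * C))
        ≈⟨ +-congˡ (*-congʳ (ι-fromℕ-suc (suc k))) ⟩
      a * A + (1# + n) * ((b - a) * (b * C))
        ≈⟨ solve 5 (λ a b A C n →
             a :* A :+ (con 1ℚ :+ n) :* ((b :- a) :* (b :* C)) :=
             b :* (b :* C) :+ (b :* (A :+ n :* ((b :- a) :* C) :- b :* C) :+ (b :- a) :* (b :* C :- A)))
             ≈-refl a b A C n ⟩
      b * (b * C) + (b * (A + n * ((b - a) * C) - b * C) + (b - a) * (b * C - A)) ∎)
    where
    open ≤-Reasoning
    A = a ^ suc k
    C = b ^ k
    n = ι (fromℕ (suc k))

  monomial : ℕ → Carrier → Carrier
  monomial k x = ι (1/! k) * x ^ k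

  0≤1/! : ∀ k → 0# ≤ ι (1/! k)
  0≤1/! k = 0≤ι (ℚ.<⇒≤ (0<1/! k))

  monomial-nonNeg : ∀ {a} k → 0# ≤ a → 0# ≤ monomial k a
  monomial-nonNeg k 0≤a = 0≤* (0≤1/! k) (^-nonNeg k 0≤a)

  monomial-mono-≤ : ∀ {a b} k → 0# ≤ a → a ≤ b → monomial k a ≤ monomial k b
  monomial-mono-≤ k 0≤a a≤b = *-monoˡ-≤ (0≤1/! k) (^-mono-≤ k 0≤a a≤b)

  monomial-tangent : ∀ {a b} k → 0# ≤ a → a ≤ b →
    monomial (suc k) b ≤ monomial (suc k) a + (b - a) * monomial k b
  monomial-tangent {a} {b} k 0≤a a≤b = begin
    f * b ^ suc k
      ≤⟨ *-monoˡ-≤ (0≤1/! (suc k)) (^-tangent k 0≤a a≤b) ⟩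
    f * (a ^ suc k + n * ((b - a) * b ^ k))
      ≈⟨ solve 5 (λ f A n x B → f :* (A :+ n :* (x :* B)) := f :* A :+ x :* ((f :* n) :* B)) ≈-refl _ _ _ _ _ ⟩
    f * a ^ suc k + (b - a) * ((f * n) * b ^ k)
      ≈⟨ +-congˡ (*-congˡ (*-congʳ (≈-trans (≈-sym (ι-* _ _)) (≈-reflexive (cong ι (1/!-suc k)))))) ⟩
    monomial (suc k) a + (b - a) * monomial k b ∎
    where
    open ≤-Reasoning
    f = ι (1/! (suc k))
    n = ι (fromℕ (suc k))

  exp : ℕ → Carrier → Carrier
  exp zero x = monomial zero x
  exp (suc n) x = exp n x + monomial (suc n) x

  exp-mono-≤ : ∀ {a b} n → 0# ≤ a → a ≤ b → exp n a ≤ exp n b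
  exp-mono-≤ zero 0≤a a≤b = monomial-mono-≤ 0 0≤a a≤b
  exp-mono-≤ (suc n) 0≤a a≤b = +-mono-≤ (exp-mono-≤ n 0≤a a≤b) (monomial-mono-≤ (suc n) 0≤a a≤b)

  1^k≈1 : ∀ k → 1# ^ k ≈ 1#
  1^k≈1 zero = ≈-refl
  1^k≈1 (suc k) = ≈-trans (*-identityˡ _) (1^k≈1 k)

  monomial-1 : ∀ k → monomial k 1# ≈ ι (1/! k)
  monomial-1 k = ≈-trans (*-congˡ (1^k≈1 k)) (*-identityʳ _)

  exp-1 : ∀ n → exp n 1# ≈ ι (eSeq n)
  exp-1 zero = monomial-1 0
  exp-1 (suc n) = ≈-trans (+-cong (exp-1 n) (monomial-1 (suc n))) (≈-sym (ι-+ _ _))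

  exp-0 : ∀ n → exp n 0# ≈ 1#
  exp-0 zero = *-identityʳ _
  exp-0 (suc n) = ≈-trans (+-cong (exp-0 n) (≈-trans (*-congˡ (zeroˡ _)) (zeroʳ _))) (+-identityʳ _)

  -- Strong convexity: the quadratic monomial supplies the term with `ι ½`, so the base case of
  -- degree 2 is an identity, and every further monomial adds only its own tangent inequality.
  exp-tangent : ∀ {a b} n → 0# ≤ a → a ≤ b →
    exp (2 ℕ.+ n) b ≤ exp (2 ℕ.+ n) a + ((b - a) * exp (1 ℕ.+ n) b - ι ½ * ((b - a) * (b - a)))
  exp-tangent {a} {b} zero 0≤a a≤b = ≤-reflexive (solve 2 (λ a b →
    let e1 = λ x → con (1/! 0) :* con 1ℚ :+ con (1/! 1) :* (x :* con 1ℚ)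
        e2 = λ x → e1 x :+ con (1/! 2) :* (x :* (x :* con 1ℚ))
    in e2 b := e2 a :+ ((b :- a) :* e1 b :- con ½ :* ((b :- a) :* (b :- a)))) ≈-refl a b)
  exp-tangent {a} {b} (suc n) 0≤a a≤b = begin
    exp (2 ℕ.+ n) b + monomial (3 ℕ.+ n) b
      ≤⟨ +-mono-≤ (exp-tangent n 0≤a a≤b) (monomial-tangent (2 ℕ.+ n) 0≤a a≤b) ⟩
    exp (2 ℕ.+ n) a + ((b - a) * exp (1 ℕ.+ n) b - ι ½ * ((b - a) * (b - a)))
      + (monomial (3 ℕ.+ n) a + (b - a) * monomial (2 ℕ.+ n) b)
      ≈⟨ solve 6 (λ A x B h C D → A :+ (x :* B :- h) :+ (C :+ x :* D) := A :+ C :+ (x :* (B :+ D) :- h))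
           ≈-refl _ _ _ _ _ _ ⟩
    exp (3 ℕ.+ n) a + ((b - a) * exp (2 ℕ.+ n) b - ι ½ * ((b - a) * (b - a))) ∎
    where open ≤-Reasoning

-- The potential and its constants.

-- g plays the role of the derivative of G, and 2κ that of a lower bound on its
-- second derivative.
record Potential (𝔸 : OrderedAlgebra) (δ ρ : OrderedAlgebra.Carrier 𝔸) : Set where
  open OrderedAlgebraProperties 𝔸
  field
    G g : Carrier → Carrier
    κ : Carrier
    0≤κ : 0# ≤ κ
    G-0 : G 0# ≈ 0#
    G-mono : ∀ {a b} → 0# ≤ a → a ≤ b → G a ≤ G b
    G-tangent : ∀ {a b} → 0# ≤ a → a ≤ b →
      G b ≤ G a + ((b - a) * g b - κ * ((b - a) * (b - a)))
    g≤1 : ∀ {a} → 0# ≤ a → a ≤ 1# → g a ≤ 1#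
    ρ≤G1 : ρ ≤ G 1#
    ρ≤G+1-g : ∀ {a} → 0# ≤ a → ρ ≤ G a + (1# - g a) + κ * δ

-- μ ≈ 1/e, δ = 1/d, and η bounds the tail of the exponential series at 1; ν is
-- the factor (1 - s)/e of the header.
module ExponentialPotential (𝔸 : OrderedAlgebra) where
  open OrderedAlgebraProperties 𝔸
  open Taylor 𝔸

  module _
    {δ μ η : Carrier} (n : ℕ)
    (0≤δ : 0# ≤ δ) (δ≤1 : δ ≤ 1#) (0≤η : 0# ≤ η) (η≤δ/96 : η ≤ ι (+ 1 ℚ./ 96) * δ)
    (1/3≤μ : ι (+ 1 ℚ./ 3) ≤ μ) (μ-inverse : μ * (exp (2 ℕ.+ n) 1# + η) ≈ 1#)
    where

    -- The weight `s` trades part of the convexity gain `ι ½ * ν * δ` of the saturated case for a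
    -- gain `s * μ` at level 1. As `μ ≥ 1/3`, the latter is at least δ/48, and `c` is half of 1/48.
    c s ν ρ : Carrier
    c = ι (+ 1 ℚ./ 96)
    s = ι (+ 1 ℚ./ 16) * δ
    ν = (1# - s) * μ
    ρ = (1# - μ) * (1# + c * δ)

    0≤μ : 0# ≤ μ
    0≤μ = ≤-trans (0≤ι (ℚ.nonNegative⁻¹ (+ 1 ℚ./ 3))) 1/3≤μ

    0≤ν : 0# ≤ ν
    0≤ν = 0≤* (≤-trans (0≤+ (0≤ι (ℚ.nonNegative⁻¹ (+ 15 ℚ./ 16)))
                            (0≤* (0≤ι (ℚ.nonNegative⁻¹ (+ 1 ℚ./ 16))) (sub-≥0 δ≤1)))
                (≤-reflexive (solve 1 (λ δ → con (+ 15 ℚ./ 16) :+ con (+ 1 ℚ./ 16) :* (con 1ℚ :- δ)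
                   := con 1ℚ :- con (+ 1 ℚ./ 16) :* δ) ≈-refl δ)))
              0≤μ

    G g : Carrier → Carrier
    G x = ν * (exp (2 ℕ.+ n) x - 1#) + s * x
    g x = ν * exp (1 ℕ.+ n) x + s

    ν*E : ν * (exp (2 ℕ.+ n) 1# + η) ≈ 1# - s
    ν*E = begin-equality
      (1# - s) * μ * (exp (2 ℕ.+ n) 1# + η)
        ≈⟨ solve 3 (λ s μ E → s :* μ :* E := s :* (μ :* E)) ≈-refl _ _ _ ⟩
      (1# - s) * (μ * (exp (2 ℕ.+ n) 1# + η))   ≈⟨ *-congˡ μ-inverse ⟩
      (1# - s) * 1#                             ≈⟨ *-identityʳ _ ⟩
      1# - s                                    ∎
      where open ≤-Reasoning

    0≤s : 0# ≤ s
    0≤s = 0≤* (0≤ι (ℚ.nonNegative⁻¹ (+ 1 ℚ./ 16))) 0≤δ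

    G-0 : G 0# ≈ 0#
    G-0 = ≈-trans (+-congʳ (*-congˡ (+-congʳ (exp-0 (2 ℕ.+ n)))))
      (solve 2 (λ ν s → ν :* (con 1ℚ :- con 1ℚ) :+ s :* con 0ℚ := con 0ℚ) ≈-refl ν s)

    G-mono : ∀ {a b} → 0# ≤ a → a ≤ b → G a ≤ G b
    G-mono {a} {b} 0≤a a≤b = by-difference
      (0≤+ (0≤* 0≤ν (sub-≥0 (exp-mono-≤ (2 ℕ.+ n) 0≤a a≤b))) (0≤* 0≤s (sub-≥0 a≤b)))
      (solve 6 (λ ν A B s a b → ν :* (B :- con 1ℚ) :+ s :* b :=
        ν :* (A :- con 1ℚ) :+ s :* a :+ (ν :* (B :- A) :+ s :* (b :- a))) ≈-refl _ _ _ _ _ _)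

    G-tangent : ∀ {a b} → 0# ≤ a → a ≤ b →
      G b ≤ G a + ((b - a) * g b - ι ½ * ν * ((b - a) * (b - a)))
    G-tangent {a} {b} 0≤a a≤b = by-difference (0≤* 0≤ν (sub-≥0 (exp-tangent n 0≤a a≤b)))
      (solve 7 (λ ν A B C s a b →
        ν :* (A :- con 1ℚ) :+ s :* a
          :+ ((b :- a) :* (ν :* C :+ s) :- con ½ :* ν :* ((b :- a) :* (b :- a))) :=
        ν :* (B :- con 1ℚ) :+ s :* b
          :+ ν :* (A :+ ((b :- a) :* C :- con ½ :* ((b :- a) :* (b :- a))) :- B)) ≈-refl _ _ _ _ _ _ _)

    -- This is what the normalisation by `exp (2 + n) 1# + η` is for: `ν` times it is `1 - s`, and
    -- it dominates `exp (1 + n)` on the unit interval.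
    g≤1 : ∀ {a} → 0# ≤ a → a ≤ 1# → g a ≤ 1#
    g≤1 {a} 0≤a a≤1 = begin
      ν * exp (1 ℕ.+ n) a + s           ≤⟨ +-mono-≤ (*-monoˡ-≤ 0≤ν exp≤) ≤-refl ⟩
      ν * (exp (2 ℕ.+ n) 1# + η) + s    ≈⟨ +-congʳ ν*E ⟩
      1# - s + s                        ≈⟨ solve 1 (λ s → con 1ℚ :- s :+ s := con 1ℚ) ≈-refl s ⟩
      1#                                ∎
      where
      open ≤-Reasoning
      exp≤ : exp (1 ℕ.+ n) a ≤ exp (2 ℕ.+ n) 1# + η
      exp≤ = by-difference
        (0≤+ (sub-≥0 (exp-mono-≤ (1 ℕ.+ n) 0≤a a≤1))
             (0≤+ (monomial-nonNeg (2 ℕ.+ n) 0≤1#) 0≤η))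
        (solve 4 (λ A B M η → B :+ M :+ η := A :+ (B :- A :+ (M :+ η))) ≈-refl _ _ _ _)

    -- Up to the series error `ν * η`, the value `G 1#` is `1 - μ + s * μ`. Here `s * μ ≥ 2 * c * δ`
    -- covers both the required gain `(1 - μ) * c * δ` and the error, which is at most `μ * c * δ`.
    ρ≤G1 : ρ ≤ G 1#
    ρ≤G1 = by-difference
      (0≤+ (0≤* 0≤μ (sub-≥0 η≤δ/96))
        (0≤+ (0≤* (0≤* 0≤s 0≤μ) 0≤η)
          (0≤+ (0≤* 0≤s (sub-≥0 1/3≤μ)) (0≤* (0≤ι (ℚ.nonNegative⁻¹ (+ 1 ℚ./ 96))) 0≤δ))))
      (begin-equality
        ν * (E - 1#) + s * 1#
          ≈⟨ solve 4 (λ ν E η s → ν :* (E :- con 1ℚ) :+ s :* con 1ℚ := ν :* (E :+ η) :- ν :* η :- ν :+ s)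
               ≈-refl _ _ η _ ⟩
        ν * (E + η) - ν * η - ν + s
          ≈⟨ +-congʳ (+-congʳ (+-congʳ ν*E)) ⟩
        1# - s - ν * η - ν + s
          ≈⟨ solve 3 (λ δ μ η →
               let c = con (+ 1 ℚ./ 96)
                   s = con (+ 1 ℚ./ 16) :* δ
                   ν = (con 1ℚ :- s) :* μ
               in con 1ℚ :- s :- ν :* η :- ν :+ s :=
                  (con 1ℚ :- μ) :* (con 1ℚ :+ c :* δ)
                  :+ (μ :* (c :* δ :- η)
                    :+ (s :* μ :* η :+ (s :* (μ :- con (+ 1 ℚ./ 3)) :+ c :* δ)))) ≈-refl δ μ η ⟩
        ρ + (μ * (c * δ - η) + (s * μ * η + (s * (μ - ι (+ 1 ℚ./ 3)) + c * δ))) ∎)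
      where
      open ≤-Reasoning
      E = exp (2 ℕ.+ n) 1#

    -- The exponentials in `G` and `g` cancel except for the top monomial. What is left is
    -- `(1 - μ) * (1 - s)`, the convexity gain and nonnegative terms in `a`.
    ρ≤G+1-g : ∀ {a} → 0# ≤ a → ρ ≤ G a + (1# - g a) + ι ½ * ν * δ
    ρ≤G+1-g {a} 0≤a = by-difference
      (0≤+ (0≤* 0≤ν (monomial-nonNeg (2 ℕ.+ n) 0≤a))
        (0≤+ (0≤* 0≤s 0≤a)
          (0≤* (0≤* (0≤ι (ℚ.nonNegative⁻¹ (+ 1 ℚ./ 96))) 0≤δ)
            -- In units of `c * δ`, `s` is 6 and `ι ½ * ν * δ` is `48 * μ - 3 * μ * δ`. The surplus
            -- `55 * μ - 7 - 3 * μ * δ` is regrouped as `52 * (μ - 1/3) + 31/3 + 3 * μ * (1 - δ)`.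
            (0≤+ (0≤* (0≤ι (ℚ.nonNegative⁻¹ (fromℕ 52))) (sub-≥0 1/3≤μ))
              (0≤+ (0≤ι (ℚ.nonNegative⁻¹ (+ 31 ℚ./ 3)))
                   (0≤* (0≤* (0≤ι (ℚ.nonNegative⁻¹ (fromℕ 3))) 0≤μ) (sub-≥0 δ≤1)))))))
      (solve 5 (λ δ μ M E a →
        let c = con (+ 1 ℚ./ 96)
            s = con (+ 1 ℚ./ 16) :* δ
            ν = (con 1ℚ :- s) :* μ
        in ν :* (E :+ M :- con 1ℚ) :+ s :* a :+ (con 1ℚ :- (ν :* E :+ s)) :+ con ½ :* ν :* δ :=
           (con 1ℚ :- μ) :* (con 1ℚ :+ c :* δ)
           :+ (ν :* M :+ (s :* a :+ (c :* δ) :* (con (fromℕ 52) :* (μ :- con (+ 1 ℚ./ 3))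
                :+ (con (+ 31 ℚ./ 3) :+ con (fromℕ 3) :* μ :* (con 1ℚ :- δ)))))) ≈-refl _ _ _ _ _)

    potential : Potential 𝔸 δ ρ
    potential = record
      { G = G
      ; g = g
      ; κ = ι ½ * ν
      ; 0≤κ = 0≤* (0≤ι (ℚ.nonNegative⁻¹ ½)) 0≤ν
      ; G-0 = G-0
      ; G-mono = G-mono
      ; G-tangent = G-tangent
      ; g≤1 = g≤1
      ; ρ≤G1 = ρ≤G1
      ; ρ≤G+1-g = ρ≤G+1-g
      }

-- Arrival times, water levels over time, and weak duality.

lookup-ext : ∀ {n} {S T : Subset n} → (∀ k → lookup S k ≡ lookup T k) → S ≡ T
lookup-ext {S = S} {T} eq =
  ≡.trans (≡.sym (tabulate∘lookup S)) (≡.trans (tabulate-cong eq) (tabulate∘lookup T))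

does-true : ∀ {A : Set} (a? : Dec A) → does a? ≡ true → A
does-true (yes a) _ = a

module WaterFilling (𝔸 : OrderedAlgebra) {m n} (Γ : BipartiteGraph m n) (π : ArrivalOrder n) where
  open OrderedAlgebraProperties 𝔸

  Allocation : Set
  Allocation = Fin m → Fin n → Carrier

  value : Allocation → Carrier
  value x = ∑ ⊤ (λ j → ∑ (nbr Γ j) (λ i → x i j))

  record IsFractionalMatching (x : Allocation) : Set where
    field
      nonneg  : ∀ i j → i ∈ nbr Γ j → 0# ≤ x i j
      offline : ∀ i → ∑ (nbrᴸ Γ i) (x i) ≤ 1#
      online  : ∀ j → ∑ (nbr Γ j) (λ i → x i j) ≤ 1#

  waterLevel : Allocation → Fin m → Fin n → Carrier
  waterLevel x i j = ∑ (nbrᴸ Γ i ∩ arrivedBefore π j) (x i)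

  Fillable : Allocation → Fin n → Carrier → Set
  Fillable x j ℓ = 0# ≤ ℓ × ℓ ≤ 1# × ∑ (nbr Γ j) (λ i → 0# ⊔ (ℓ - waterLevel x i j)) ≤ 1#

  IsWaterFilling : Allocation → Set
  IsWaterFilling x = ∀ j → ∃[ ℓ ] (Fillable x j ℓ × (∀ ℓ′ → Fillable x j ℓ′ → ℓ′ ≤ ℓ))
    × (∀ i → i ∈ nbr Γ j → x i j ≈ 0# ⊔ (ℓ - waterLevel x i j))

  Fillable-resp-≈ : ∀ x j ℓ f → (∀ i → f i ≈ 0# ⊔ (ℓ - waterLevel x i j)) →
    (0# ≤ ℓ × ℓ ≤ 1# × ∑ (nbr Γ j) f ≤ 1# → Fillable x j ℓ) ×
    (Fillable x j ℓ → 0# ≤ ℓ × ℓ ≤ 1# × ∑ (nbr Γ j) f ≤ 1#)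
  Fillable-resp-≈ x j ℓ f f≈ =
      (λ (0≤ℓ , ℓ≤1 , fits) → 0≤ℓ , ℓ≤1 , ≤-trans (≤-reflexive (∑-cong (nbr Γ j) (λ i _ → ≈-sym (f≈ i)))) fits)
    , (λ (0≤ℓ , ℓ≤1 , fits) → 0≤ℓ , ℓ≤1 , ≤-trans (≤-reflexive (∑-cong (nbr Γ j) (λ i _ → f≈ i))) fits)

  time : Fin n → ℕ
  time j = toℕ (π ⟨$⟩ʳ j)

  time-injective : ∀ {j k} → time j ≡ time k → j ≡ k
  time-injective {j} {k} eq = ≡.trans (≡.sym (inverseˡ π))
    (≡.trans (cong (π ⟨$⟩ˡ_) (Fin.toℕ-injective eq)) (inverseˡ π))

  -- `P t` speaks of the state after `t` arrivals. Since `π` is a permutation, every `t < n` is the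
  -- arrival time of some vertex, so a step per vertex suffices.
  arrival-induction : (P : ℕ → Set) → P 0 → (∀ j → P (time j) → P (suc (time j))) →
    ∀ t → t ℕ.≤ n → P t
  arrival-induction P base step zero _ = base
  arrival-induction P base step (suc t) t<n =
    subst (P ∘ suc) time-j (step j (subst P (≡.sym time-j)
      (arrival-induction P base step t (ℕ.<⇒≤ t<n))))
    where
    j = π ⟨$⟩ˡ fromℕ< t<n
    time-j : time j ≡ t
    time-j = ≡.trans (cong toℕ (inverseʳ π)) (Fin.toℕ-fromℕ< t<n)

  -- Written with `suc (time j) ℕ.≤? t` so that `before (time j)` unfolds to `arrivedBefore π j`,
  -- and `waterLevel x i j` is `level x i (time j)` by definition.
  before : ℕ → Subset n
  before t = tabulate (λ j → does (suc (time j) ℕ.≤? t))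

  level : Allocation → Fin m → ℕ → Carrier
  level x i t = ∑ (nbrᴸ Γ i ∩ before t) (x i)

  lookup-nbrᴸ : ∀ i j → lookup (nbrᴸ Γ i) j ≡ lookup (nbr Γ j) i
  lookup-nbrᴸ i j = lookup∘tabulate (λ k → lookup (nbr Γ k) i) j

  ∈-nbrᴸ⇒∈-nbr : ∀ {i j} → j ∈ nbrᴸ Γ i → i ∈ nbr Γ j
  ∈-nbrᴸ⇒∈-nbr {i} {j} j∈ = lookup⇒[]= i _ (≡.trans (≡.sym (lookup-nbrᴸ i j)) ([]=⇒lookup j∈))

  lookup-∩-before : ∀ i t k →
    lookup (nbrᴸ Γ i ∩ before t) k ≡ lookup (nbr Γ k) i ∧ does (suc (time k) ℕ.≤? t)
  lookup-∩-before i t k = ≡.trans (lookup-zipWith _∧_ k (nbrᴸ Γ i) (before t))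
    (cong₂ _∧_ (lookup-nbrᴸ i k) (lookup∘tabulate (λ j → does (suc (time j) ℕ.≤? t)) k))

  ∈-before⇒< : ∀ {t k} → k ∈ before t → time k ℕ.< t
  ∈-before⇒< {t} {k} k∈ = does-true (suc (time k) ℕ.≤? t)
    (≡.trans (≡.sym (lookup∘tabulate (λ j → does (suc (time j) ℕ.≤? t)) k)) ([]=⇒lookup k∈))

  level-zero : ∀ x i → level x i 0 ≈ 0#
  level-zero x i = ≈-trans (∑-cong S (λ k k∈ → empty k (proj₂ (x∈p∩q⁻ (nbrᴸ Γ i) (before 0) k∈)))) (∑-0 S)
    where
    S = nbrᴸ Γ i ∩ before 0
    empty : ∀ k → k ∈ before 0 → x i k ≈ 0#
    empty k k∈ with () ← ∈-before⇒< {0} k∈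

  level-end : ∀ x i → level x i n ≡ ∑ (nbrᴸ Γ i) (x i)
  level-end x i = cong (λ S → ∑ S (x i)) (lookup-ext λ k → begin
    lookup (nbrᴸ Γ i ∩ before n) k
      ≡⟨ lookup-∩-before i n k ⟩
    lookup (nbr Γ k) i ∧ does (suc (time k) ℕ.≤? n)
      ≡⟨ cong (lookup (nbr Γ k) i ∧_) (dec-true (suc (time k) ℕ.≤? n) (Fin.toℕ<n (π ⟨$⟩ʳ k))) ⟩
    lookup (nbr Γ k) i ∧ true
      ≡⟨ ∧-identityʳ _ ⟩
    lookup (nbr Γ k) i
      ≡⟨ lookup-nbrᴸ i k ⟨
    lookup (nbrᴸ Γ i) k ∎)
    where
    open ≡-Reasoning

  level-step : ∀ x i j →
    level x i (suc (time j)) ≈ level x i (time j) + indicator (lookup (nbr Γ j) i) (x i j)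
  level-step x i j = by-cases (lookup (nbr Γ j) i) refl
    where
    S = nbrᴸ Γ i ∩ before (time j)
    S′ = nbrᴸ Γ i ∩ before (suc (time j))

    lookup-S-j : lookup S j ≡ false
    lookup-S-j = ≡.trans (lookup-∩-before i (time j) j)
      (≡.trans (cong (lookup (nbr Γ j) i ∧_) (dec-false (suc (time j) ℕ.≤? time j) ℕ.1+n≰n)) (∧-zeroʳ _))

    lookup-S′-j : lookup S′ j ≡ lookup (nbr Γ j) i
    lookup-S′-j = ≡.trans (lookup-∩-before i (suc (time j)) j)
      (≡.trans (cong (lookup (nbr Γ j) i ∧_) (dec-true (suc (time j) ℕ.≤? suc (time j)) ℕ.≤-refl)) (∧-identityʳ _))

    agree : ∀ k → ¬ k ≡ j → lookup S k ≡ lookup S′ k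
    agree k k≢j = ≡.trans (lookup-∩-before i (time j) k) (≡.trans
      (cong (lookup (nbr Γ k) i ∧_) (does-⇔ (mk⇔ ℕ.m≤n⇒m≤1+n
        (λ k≤j → ℕ.≤∧≢⇒< (ℕ.s≤s⁻¹ k≤j) (k≢j ∘ time-injective)))
        (suc (time k) ℕ.≤? time j) (suc (time k) ℕ.≤? suc (time j))))
      (≡.sym (lookup-∩-before i (suc (time j)) k)))

    by-cases : ∀ b → lookup (nbr Γ j) i ≡ b →
      level x i (suc (time j)) ≈ level x i (time j) + indicator (lookup (nbr Γ j) i) (x i j)
    by-cases true eq = ≈-trans (∑-insert S S′ j (x i) lookup-S-j (≡.trans lookup-S′-j eq) agree)
      (+-congˡ (≈-reflexive (cong (λ b → indicator b (x i j)) (≡.sym eq))))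
    by-cases false eq = ≈-trans
      (≈-reflexive (cong (λ T → ∑ T (x i)) (lookup-ext {S = S′} {S} same)))
      (≈-trans (≈-sym (+-identityʳ _)) (+-congˡ (≈-reflexive (cong (λ b → indicator b (x i j)) (≡.sym eq)))))
      where
      same : ∀ k → lookup S′ k ≡ lookup S k
      same k with k Fin.≟ j
      ... | yes refl = ≡.trans lookup-S′-j (≡.trans eq (≡.sym lookup-S-j))
      ... | no k≢j = ≡.sym (agree k k≢j)

  level-step-∈ : ∀ x {i j} → i ∈ nbr Γ j → level x i (suc (time j)) ≈ waterLevel x i j + x i j
  level-step-∈ x {i} {j} i∈ = ≈-trans (level-step x i j)
    (+-congˡ (≈-reflexive (cong (λ b → indicator b (x i j)) ([]=⇒lookup i∈))))

  NonNegative : Allocation → Set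
  NonNegative x = ∀ i j → i ∈ nbr Γ j → 0# ≤ x i j

  0≤level : ∀ {x} → NonNegative x → ∀ i t → 0# ≤ level x i t
  0≤level 0≤x i t = 0≤∑ _ (λ j j∈ → 0≤x i j (∈-nbrᴸ⇒∈-nbr (proj₁ (x∈p∩q⁻ (nbrᴸ Γ i) (before t) j∈))))

  -- Each edge constraint is weighted by `z i j` and the results are summed. Then `α i` and `β j`
  -- acquire as coefficients the loads of `z` at `i` and `j`, which are at most 1.
  weak-duality : ∀ {α β ρ z} → (∀ i → 0# ≤ α i) → (∀ j → 0# ≤ β j) →
    (∀ i j → i ∈ nbr Γ j → ρ ≤ α i + β j) → IsFractionalMatching z →
    ρ * value z ≤ ∑ ⊤ α + ∑ ⊤ β
  weak-duality {α} {β} {ρ} {z} 0≤α 0≤β ρ≤α+β Z = begin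
    ρ * value z
      ≈⟨ ∑-*ˡ ⊤ ρ _ ⟨
    ∑ ⊤ (λ j → ρ * ∑ (nbr Γ j) (λ i → z i j))
      ≤⟨ ∑-mono-≤ ⊤ (λ j _ → per-online j) ⟩
    ∑ ⊤ (λ j → ∑ (nbr Γ j) (λ i → α i * z i j) + β j)
      ≈⟨ ∑-+ ⊤ _ _ ⟩
    ∑ ⊤ (λ j → ∑ (nbr Γ j) (λ i → α i * z i j)) + ∑ ⊤ β
      ≈⟨ +-congʳ (∑-swap (nbr Γ) (λ i j → α i * z i j)) ⟩
    ∑ ⊤ (λ i → ∑ (nbrᴸ Γ i) (λ j → α i * z i j)) + ∑ ⊤ β
      ≤⟨ +-mono-≤ (∑-mono-≤ ⊤ (λ i _ → per-offline i)) ≤-refl ⟩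
    ∑ ⊤ α + ∑ ⊤ β ∎
    where
    open ≤-Reasoning
    open IsFractionalMatching Z
    per-offline : ∀ i → ∑ (nbrᴸ Γ i) (λ j → α i * z i j) ≤ α i
    per-offline i = begin
      ∑ (nbrᴸ Γ i) (λ j → α i * z i j)   ≈⟨ ∑-*ˡ (nbrᴸ Γ i) (α i) (z i) ⟩
      α i * ∑ (nbrᴸ Γ i) (z i)           ≤⟨ *-monoˡ-≤ (0≤α i) (offline i) ⟩
      α i * 1#                           ≈⟨ *-identityʳ _ ⟩
      α i                                ∎
    per-online : ∀ j → ρ * ∑ (nbr Γ j) (λ i → z i j) ≤ ∑ (nbr Γ j) (λ i → α i * z i j) + β j
    per-online j = begin
      ρ * ∑ (nbr Γ j) (λ i → z i j)
        ≈⟨ ∑-*ˡ (nbr Γ j) ρ _ ⟨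
      ∑ (nbr Γ j) (λ i → ρ * z i j)
        ≤⟨ ∑-mono-≤ (nbr Γ j) (λ i i∈ → by-difference
             (0≤* (nonneg i j i∈) (sub-≥0 (ρ≤α+β i j i∈)))
             (solve 4 (λ z α β ρ → α :* z :+ β :* z := ρ :* z :+ z :* (α :+ β :- ρ)) ≈-refl _ _ _ _)) ⟩
      ∑ (nbr Γ j) (λ i → α i * z i j + β j * z i j)
        ≈⟨ ≈-trans (∑-+ (nbr Γ j) _ _) (+-congˡ (∑-*ˡ (nbr Γ j) (β j) _)) ⟩
      ∑ (nbr Γ j) (λ i → α i * z i j) + β j * ∑ (nbr Γ j) (λ i → z i j)
        ≤⟨ +-mono-≤ ≤-refl (*-monoˡ-≤ (0≤β j) (online j)) ⟩
      ∑ (nbr Γ j) (λ i → α i * z i j) + β j * 1#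
        ≈⟨ +-congˡ (*-identityʳ _) ⟩
      ∑ (nbr Γ j) (λ i → α i * z i j) + β j ∎

  -- Invariants of a water-filling run.

  module Run (x : Allocation) (W : IsWaterFilling x) where

    fill : Fin n → Carrier
    fill j = proj₁ (W j)

    0≤fill : ∀ j → 0# ≤ fill j
    0≤fill j = proj₁ (proj₁ (proj₁ (proj₂ (W j))))

    fill≤1 : ∀ j → fill j ≤ 1#
    fill≤1 j = proj₁ (proj₂ (proj₁ (proj₁ (proj₂ (W j)))))

    x≈ : ∀ {i j} → i ∈ nbr Γ j → x i j ≈ 0# ⊔ (fill j - waterLevel x i j)
    x≈ {i} {j} = proj₂ (proj₂ (W j)) i

    nonneg : NonNegative x
    nonneg i j i∈ = ≤-trans (x≤x⊔y 0# _) (≤-reflexive (≈-sym (x≈ i∈)))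

    used : Fin n → Carrier
    used j = ∑ (nbr Γ j) (λ i → x i j)

    used≈ : ∀ j → used j ≈ ∑ (nbr Γ j) (λ i → 0# ⊔ (fill j - waterLevel x i j))
    used≈ j = ∑-cong (nbr Γ j) (λ i → x≈)

    online : ∀ j → used j ≤ 1#
    online j = ≤-trans (≤-reflexive (used≈ j)) (proj₂ (proj₂ (proj₁ (proj₁ (proj₂ (W j))))))

    filled-below : ∀ {i j} → i ∈ nbr Γ j → waterLevel x i j ≤ fill j → x i j ≈ fill j - waterLevel x i j
    filled-below i∈ y≤ℓ = ≈-trans (x≈ i∈) (x≤y⇒x⊔y≈y (sub-≥0 y≤ℓ))

    filled-above : ∀ {i j} → i ∈ nbr Γ j → fill j ≤ waterLevel x i j → x i j ≈ 0#
    filled-above {i} {j} i∈ ℓ≤y = ≈-trans (x≈ i∈) (y≤x⇒x⊔y≈x (by-difference (sub-≥0 ℓ≤y)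
      (solve 2 (λ ℓ y → con 0ℚ := ℓ :- y :+ (y :- ℓ)) ≈-refl _ _)))

    y+x≈fill : ∀ {i j} → i ∈ nbr Γ j → waterLevel x i j ≤ fill j → waterLevel x i j + x i j ≈ fill j
    y+x≈fill i∈ y≤ℓ = ≈-trans (+-congˡ (filled-below i∈ y≤ℓ))
      (solve 2 (λ y ℓ → y :+ (ℓ :- y) := ℓ) ≈-refl _ _)

    fill≤y+x : ∀ {i j} → i ∈ nbr Γ j → fill j ≤ waterLevel x i j + x i j
    fill≤y+x {i} {j} i∈ = by-difference
      (sub-≥0 (≤-trans (y≤x⊔y 0# _) (≤-reflexive (≈-sym (x≈ i∈)))))
      (solve 3 (λ y x ℓ → y :+ x := ℓ :+ (x :- (ℓ :- y))) ≈-refl _ _ _)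

    -- A neighbour below the level ends exactly at `fill j`, which is at most 1; any other vertex
    -- keeps its water level.
    level≤1 : ∀ i t → t ℕ.≤ n → level x i t ≤ 1#
    level≤1 i = arrival-induction (λ t → level x i t ≤ 1#)
      (≤-trans (≤-reflexive (level-zero x i)) 0≤1#)
      (λ j y≤1 → ≤-trans (≤-reflexive (level-step x i j)) (step j y≤1 (lookup (nbr Γ j) i) refl))
      where
      step : ∀ j → waterLevel x i j ≤ 1# → ∀ b → lookup (nbr Γ j) i ≡ b →
        waterLevel x i j + indicator b (x i j) ≤ 1#
      step j y≤1 false _ = ≤-trans (≤-reflexive (+-identityʳ _)) y≤1
      step j y≤1 true i∈ = ≤-cases (waterLevel x i j) (fill j)
        (λ y≤ℓ → ≤-trans (≤-reflexive (y+x≈fill (lookup⇒[]= i _ i∈) y≤ℓ)) (fill≤1 j))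
        (λ ℓ≤y → ≤-trans (≤-reflexive (≈-trans (+-congˡ (filled-above (lookup⇒[]= i _ i∈) ℓ≤y)) (+-identityʳ _))) y≤1)

    y+x≤1 : ∀ {i j} → i ∈ nbr Γ j → waterLevel x i j + x i j ≤ 1#
    y+x≤1 {i} {j} i∈ = ≤-trans (≤-reflexive (≈-sym (level-step-∈ x i∈)))
      (level≤1 i (suc (time j)) (Fin.toℕ<n (π ⟨$⟩ʳ j)))

    final : Fin m → Carrier
    final i = ∑ (nbrᴸ Γ i) (x i)

    isFractionalMatching : IsFractionalMatching x
    isFractionalMatching = record
      { nonneg = nonneg
      ; offline = λ i → ≤-trans (≤-reflexive (≈-reflexive (≡.sym (level-end x i)))) (level≤1 i n ℕ.≤-refl)
      ; online = online
      }

    0≤y : ∀ i j → 0# ≤ waterLevel x i j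
    0≤y i j = 0≤level nonneg i (time j)

    y+x≤final : ∀ {i j} → i ∈ nbr Γ j → waterLevel x i j + x i j ≤ final i
    y+x≤final {i} {j} i∈ = ≤-trans (≤-reflexive (≈-sym (level-step-∈ x i∈)))
      (∑-⊆ (nbrᴸ Γ i ∩ before (suc (time j))) (nbrᴸ Γ i)
        (λ k k∈ → proj₁ (x∈p∩q⁻ (nbrᴸ Γ i) _ k∈)) (λ k k∈ → nonneg i k (∈-nbrᴸ⇒∈-nbr k∈)))

    -- Maximality of the level: were both bounds slack by r, the level could be
    -- raised by r / (1 + deg j).
    slack-≤0 : ∀ j {r} → 0# ≤ r → r ≤ 1# - fill j → r ≤ 1# - used j → r ≤ 0#
    slack-≤0 j {r} 0≤r r≤1-ℓ r≤1-T = begin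
      r                  ≈⟨ *-identityˡ r ⟨
      1# * r             ≈⟨ *-congʳ K*q ⟨
      (1# + D) * q * r   ≈⟨ solve 3 (λ K q r → K :* q :* r := K :* (q :* r)) ≈-refl _ _ _ ⟩
      (1# + D) * (q * r) ≤⟨ *-monoˡ-≤ (0≤+ 0≤1# (0≤ι-fromℕ d)) qr≤0 ⟩
      (1# + D) * 0#      ≈⟨ zeroʳ _ ⟩
      0#                 ∎
      where
      open ≤-Reasoning
      d = degree Γ j
      D = ι (fromℕ d)
      q = ι (+ 1 ℚ./ suc d)
      K*q : (1# + D) * q ≈ 1#
      K*q = ≈-trans (*-congʳ (≈-sym (ι-fromℕ-suc d))) (ι-fromℕ-*-1/ d)
      0≤qr = 0≤* (0≤ι-1/ d) 0≤r
      D*qr : D * (q * r) ≈ r - q * r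
      D*qr = begin-equality
        D * (q * r)                ≈⟨ solve 3 (λ D q r → D :* (q :* r) := (con 1ℚ :+ D) :* q :* r :- q :* r) ≈-refl _ _ _ ⟩
        (1# + D) * q * r - q * r   ≈⟨ +-congʳ (≈-trans (*-congʳ K*q) (*-identityˡ r)) ⟩
        r - q * r                  ∎
      qr≤r : q * r ≤ r
      qr≤r = by-difference (0≤* (0≤ι-fromℕ d) 0≤qr) (≈-sym (≈-trans (+-congˡ D*qr)
        (solve 2 (λ a r → a :+ (r :- a) := r) ≈-refl _ _)))
      raised : Fillable x j (fill j + q * r)
      raised = 0≤+ (0≤fill j) 0≤qr
        , by-difference (sub-≥0 (≤-trans qr≤r r≤1-ℓ))
            (solve 2 (λ ℓ a → con 1ℚ := ℓ :+ a :+ (con 1ℚ :- ℓ :- a)) ≈-refl _ _)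
        , (begin
          ∑ (nbr Γ j) (λ i → 0# ⊔ (fill j + q * r - waterLevel x i j))
            ≤⟨ ∑-mono-≤ (nbr Γ j) (λ i i∈ → ⊔-lub (0≤+ (nonneg i j i∈) 0≤qr)
                 (by-difference (sub-≥0 (fill≤y+x i∈))
                   (solve 4 (λ x a ℓ y → x :+ a := ℓ :+ a :- y :+ (y :+ x :- ℓ)) ≈-refl _ _ _ _))) ⟩
          ∑ (nbr Γ j) (λ i → x i j + q * r)
            ≈⟨ ≈-trans (∑-+ (nbr Γ j) _ _) (+-congˡ (∑-const (nbr Γ j) _)) ⟩
          used j + D * (q * r)
            ≈⟨ +-congˡ D*qr ⟩
          used j + (r - q * r)
            ≤⟨ by-difference (0≤+ (sub-≥0 r≤1-T) 0≤qr)
                 (solve 3 (λ T r a → con 1ℚ := T :+ (r :- a) :+ (con 1ℚ :- T :- r :+ a)) ≈-refl _ _ _) ⟩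
          1# ∎)
      qr≤0 : q * r ≤ 0#
      qr≤0 = by-difference (sub-≥0 (proj₂ (proj₁ (proj₂ (W j))) _ raised))
        (solve 2 (λ ℓ a → con 0ℚ := a :+ (ℓ :- (ℓ :+ a))) ≈-refl _ _)

    1-a≤0⇒1≤a : ∀ {a} → 1# - a ≤ 0# → 1# ≤ a
    1-a≤0⇒1≤a 1-a≤0 = by-difference (sub-≥0 1-a≤0)
      (solve 1 (λ a → a := con 1ℚ :+ (con 0ℚ :- (con 1ℚ :- a))) ≈-refl _)

    -- The smaller of the two slacks satisfies both bounds of `slack-≤0` and hence vanishes. Which
    -- one is smaller is settled by `≤-cases`, so the disjunction takes the form of an eliminator.
    full-or-saturated : ∀ j {a b} → (1# ≤ fill j → a ≤ b) → (1# ≤ used j → a ≤ b) → a ≤ b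
    full-or-saturated j full saturated = ≤-cases (1# - fill j) (1# - used j)
      (λ p → full (1-a≤0⇒1≤a (slack-≤0 j (sub-≥0 (fill≤1 j)) ≤-refl p)))
      (λ p → saturated (1-a≤0⇒1≤a (slack-≤0 j (sub-≥0 (online j)) p ≤-refl)))

    -- The dual solution built from a potential.

    module Charging {δ ρ} (P : Potential 𝔸 δ ρ) (0≤δ : 0# ≤ δ)
      (deg*δ≤1 : ∀ j → ι (fromℕ (degree Γ j)) * δ ≤ 1#) where
      open Potential P

      -- A `Potential` carries bare functions on the carrier; for `G`, congruence comes from
      -- monotonicity in both directions.
      G-cong : ∀ {a b} → 0# ≤ a → a ≈ b → G a ≈ G b
      G-cong 0≤a a≈b = ≤-antisym (G-mono 0≤a (≤-reflexive a≈b))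
        (G-mono (≤-trans 0≤a (≤-reflexive a≈b)) (≤-reflexive (≈-sym a≈b)))

      gain charge : Allocation
      gain i j = G (waterLevel x i j + x i j) - G (waterLevel x i j)
      charge i j = x i j - gain i j

      α : Fin m → Carrier
      α i = G (final i)

      β : Fin n → Carrier
      β j = ∑ (nbr Γ j) (λ i → charge i j)

      -- The gains at `i` telescope along the arrivals, starting from `G 0# ≈ 0#`.
      level-gain : ∀ i t → t ℕ.≤ n → level gain i t ≈ G (level x i t)
      level-gain i = arrival-induction (λ t → level gain i t ≈ G (level x i t))
        (≈-trans (level-zero gain i) (≈-sym (≈-trans (G-cong (0≤level nonneg i 0) (level-zero x i)) G-0)))
        (λ j eq → ≈-trans (level-step gain i j) (≈-trans (+-congʳ eq)
          (≈-trans (step j (lookup (nbr Γ j) i) refl)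
            (≈-sym (G-cong (0≤level nonneg i (suc (time j))) (level-step x i j))))))
        where
        step : ∀ j b → lookup (nbr Γ j) i ≡ b →
          G (waterLevel x i j) + indicator b (gain i j) ≈ G (waterLevel x i j + indicator b (x i j))
        step j true _ = solve 2 (λ a b → a :+ (b :- a) := b) ≈-refl _ _
        step j false _ = ≈-trans (+-identityʳ _) (G-cong (0≤y i j) (≈-sym (+-identityʳ _)))

      ∑-gain : ∀ i → ∑ (nbrᴸ Γ i) (gain i) ≈ α i
      ∑-gain i = ≈-trans (≈-reflexive (≡.sym (level-end gain i)))
        (≈-trans (level-gain i n ℕ.≤-refl) (≈-reflexive (cong G (level-end x i))))

      dual-value : ∑ ⊤ α + ∑ ⊤ β ≈ value x
      dual-value = begin-equality
        ∑ ⊤ α + ∑ ⊤ β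
          ≈⟨ +-congʳ (∑-cong ⊤ (λ i _ → ≈-sym (∑-gain i))) ⟩
        ∑ ⊤ (λ i → ∑ (nbrᴸ Γ i) (gain i)) + ∑ ⊤ β
          ≈⟨ +-congʳ (∑-swap (nbr Γ) gain) ⟨
        ∑ ⊤ (λ j → ∑ (nbr Γ j) (λ i → gain i j)) + ∑ ⊤ β
          ≈⟨ ∑-+ ⊤ _ _ ⟨
        ∑ ⊤ (λ j → ∑ (nbr Γ j) (λ i → gain i j) + β j)
          ≈⟨ ∑-cong ⊤ (λ j _ → ∑-+ (nbr Γ j) _ _) ⟨
        ∑ ⊤ (λ j → ∑ (nbr Γ j) (λ i → gain i j + charge i j))
          ≈⟨ ∑-cong ⊤ (λ j _ → ∑-cong (nbr Γ j) (λ i _ →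
               solve 2 (λ g x → g :+ (x :- g) := x) ≈-refl _ _)) ⟩
        value x ∎
        where open ≤-Reasoning

      0≤final : ∀ i → 0# ≤ final i
      0≤final i = 0≤∑ (nbrᴸ Γ i) (λ j j∈ → nonneg i j (∈-nbrᴸ⇒∈-nbr j∈))

      0≤α : ∀ i → 0# ≤ α i
      0≤α i = ≤-trans (≤-reflexive (≈-sym G-0)) (G-mono ≤-refl (0≤final i))

      -- By the tangent inequality the gain is at most `x i j` times `g` at the raised level, and
      -- that level is at most 1, where `g≤1` applies.
      0≤charge : ∀ {i j} → i ∈ nbr Γ j → 0# ≤ charge i j
      0≤charge {i} {j} i∈ = by-difference
        (0≤+ (sub-≥0 (G-tangent (0≤y i j) y≤y+x))
          (0≤+ (0≤* (nonneg i j i∈) (sub-≥0 (g≤1 (≤-trans (0≤y i j) y≤y+x) (y+x≤1 i∈))))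
               (0≤* 0≤κ (0≤square (x i j)))))
        (solve 6 (λ x y A B g κ → x :- (B :- A) :=
           con 0ℚ :+ (A :+ ((y :+ x :- y) :* g :- κ :* ((y :+ x :- y) :* (y :+ x :- y))) :- B
             :+ (x :* (con 1ℚ :- g) :+ κ :* (x :* x)))) ≈-refl _ _ _ _ _ _)
        where
        y≤y+x : waterLevel x i j ≤ waterLevel x i j + x i j
        y≤y+x = by-difference (nonneg i j i∈) ≈-refl

      0≤β : ∀ j → 0# ≤ β j
      0≤β j = 0≤∑ (nbr Γ j) (λ i → 0≤charge)

      slope : Fin n → Carrier
      slope j = 1# - g (fill j) + (κ * δ + κ * δ)

      -- The bound x² ≥ 2δx - δ² makes the convexity gain linear in x, so that it can
      -- be summed over the neighbours of j.
      charge-bound : ∀ {i j} → i ∈ nbr Γ j → slope j * x i j - κ * (δ * δ) ≤ charge i j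
      charge-bound {i} {j} i∈ = ≤-cases (waterLevel x i j) (fill j) below above
        where
        y = waterLevel x i j
        ℓ = fill j
        below : y ≤ ℓ → slope j * x i j - κ * (δ * δ) ≤ charge i j
        below y≤ℓ = by-difference
          (0≤+ (sub-≥0 (G-tangent (0≤y i j) y≤ℓ)) (0≤* 0≤κ (0≤square (ℓ - y - δ))))
          (≈-trans (+-cong (filled-below i∈ y≤ℓ)
                     (-‿cong (+-congʳ (G-cong (≤-trans (0≤fill j) (fill≤y+x i∈)) (y+x≈fill i∈ y≤ℓ)))))
            (≈-trans (solve 7 (λ ℓ y A B g κ δ → (ℓ :- y) :- (B :- A) :=
               (con 1ℚ :- g :+ (κ :* δ :+ κ :* δ)) :* (ℓ :- y) :- κ :* (δ :* δ)
                 :+ (A :+ ((ℓ :- y) :* g :- κ :* ((ℓ :- y) :* (ℓ :- y))) :- B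
                   :+ κ :* ((ℓ :- y :- δ) :* (ℓ :- y :- δ)))) ≈-refl ℓ y (G y) (G ℓ) (g ℓ) κ δ)
              (+-congʳ (+-congʳ (*-congˡ (≈-sym (filled-below i∈ y≤ℓ)))))))
        above : ℓ ≤ y → slope j * x i j - κ * (δ * δ) ≤ charge i j
        above ℓ≤y = begin
          slope j * x i j - κ * (δ * δ)
            ≈⟨ +-congʳ (*-congˡ (filled-above i∈ ℓ≤y)) ⟩
          slope j * 0# - κ * (δ * δ)
            ≤⟨ by-difference (0≤* 0≤κ (0≤* 0≤δ 0≤δ))
                 (solve 2 (λ s k → con 0ℚ := s :* con 0ℚ :- k :+ k) ≈-refl _ _) ⟩
          0#
            ≤⟨ 0≤charge i∈ ⟩
          charge i j ∎
          where open ≤-Reasoning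

      -- Summed over the neighbours, `charge-bound` yields `2 * κ * δ` per unit of water and loses
      -- `κ * (δ * δ)` per neighbour. As the degree times `δ` is at most 1, the loss is at most
      -- `κ * δ`.
      β-saturated : ∀ j → 1# ≤ used j → 1# - g (fill j) + κ * δ ≤ β j
      β-saturated j 1≤T = begin
        1# - g (fill j) + κ * δ
          ≤⟨ by-difference
               (0≤+ (0≤* (0≤+ (sub-≥0 (g≤1 (0≤fill j) (fill≤1 j))) (0≤+ 0≤κδ 0≤κδ)) (sub-≥0 1≤T))
                    (0≤* 0≤κδ (sub-≥0 (deg*δ≤1 j))))
               (solve 5 (λ g κ δ T D →
                 (con 1ℚ :- g :+ (κ :* δ :+ κ :* δ)) :* T :+ D :* (:- (κ :* (δ :* δ))) :=
                 con 1ℚ :- g :+ κ :* δ :+ ((con 1ℚ :- g :+ (κ :* δ :+ κ :* δ)) :* (T :- con 1ℚ)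
                   :+ κ :* δ :* (con 1ℚ :- D :* δ))) ≈-refl _ _ _ _ _) ⟩
        slope j * used j + ι (fromℕ (degree Γ j)) * (- (κ * (δ * δ)))
          ≈⟨ ≈-trans (∑-+ (nbr Γ j) _ _)
               (+-cong (∑-*ˡ (nbr Γ j) (slope j) _) (∑-const (nbr Γ j) _)) ⟨
        ∑ (nbr Γ j) (λ i → slope j * x i j - κ * (δ * δ))
          ≤⟨ ∑-mono-≤ (nbr Γ j) (λ i → charge-bound) ⟩
        β j ∎
        where
        open ≤-Reasoning
        0≤κδ = 0≤* 0≤κ 0≤δ

      dual-feasible : ∀ i j → i ∈ nbr Γ j → ρ ≤ α i + β j
      dual-feasible i j i∈ = full-or-saturated j full saturated
        where
        open ≤-Reasoning
        Gℓ≤α : G (fill j) ≤ α i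
        Gℓ≤α = G-mono (0≤fill j) (≤-trans (fill≤y+x i∈) (y+x≤final i∈))
        full : 1# ≤ fill j → ρ ≤ α i + β j
        full 1≤ℓ = begin
          ρ            ≤⟨ ρ≤G1 ⟩
          G 1#         ≤⟨ G-mono 0≤1# 1≤ℓ ⟩
          G (fill j)   ≤⟨ Gℓ≤α ⟩
          α i          ≤⟨ by-difference (0≤β j) ≈-refl ⟩
          α i + β j    ∎
        saturated : 1# ≤ used j → ρ ≤ α i + β j
        saturated 1≤T = begin
          ρ                                           ≤⟨ ρ≤G+1-g (0≤fill j) ⟩
          G (fill j) + (1# - g (fill j)) + κ * δ      ≈⟨ +-assoc _ _ _ ⟩
          G (fill j) + (1# - g (fill j) + κ * δ)      ≤⟨ +-mono-≤ Gℓ≤α (β-saturated j 1≤T) ⟩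
          α i + β j                                   ∎

      competitive : ∀ {z} → IsFractionalMatching z → ρ * value z ≤ value x
      competitive Z = ≤-trans (weak-duality 0≤α 0≤β dual-feasible Z) (≤-reflexive dual-value)

-- Existence of a water-filling allocation.

module Filling (𝔸 : OrderedAlgebra) where
  open OrderedAlgebraProperties 𝔸

  infixl 6 _⊓_
  -- The minimum, expressed through the one lattice operation that an `OrderedAlgebra` provides.
  _⊓_ : Carrier → Carrier → Carrier
  x ⊓ y = x - (0# ⊔ (x - y))

  x⊓y≤x : ∀ x y → x ⊓ y ≤ x
  x⊓y≤x x y = by-difference (x≤x⊔y 0# (x - y)) (solve 2 (λ x a → x := x :- a :+ a) ≈-refl _ _)

  x⊓y≤y : ∀ x y → x ⊓ y ≤ y
  x⊓y≤y x y = by-difference (sub-≥0 (y≤x⊔y 0# (x - y)))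
    (solve 3 (λ x y a → y := x :- a :+ (a :- (x :- y))) ≈-refl _ _ _)

  ⊓-glb : ∀ {x y z} → z ≤ x → z ≤ y → z ≤ x ⊓ y
  ⊓-glb {x} {y} {z} z≤x z≤y = by-difference
    (sub-≥0 (⊔-lub (sub-≥0 z≤x) (by-difference (sub-≥0 z≤y)
      (solve 3 (λ x y z → x :- z := x :- y :+ (y :- z)) ≈-refl _ _ _))))
    (solve 3 (λ x z a → x :- a := z :+ (x :- z :- a)) ≈-refl _ _ _)

  ⊓-cong : ∀ {w x y z} → w ≈ x → y ≈ z → w ⊓ y ≈ x ⊓ z
  ⊓-cong w≈x y≈z = +-cong w≈x (-‿cong (⊔-cong ≈-refl (+-cong w≈x (-‿cong y≈z))))

  -- Since ∑_{i∈S} max(0, ℓ - y i) = max_{T⊆S} ∑_{i∈T} (ℓ - y i), the largest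
  -- level is the minimum of 1 and of (1 + ∑_{i∈T} y i) / ∣T∣ over nonempty T ⊆ S.
  -- The accumulators k and s are ∣T∣ and ∑_{i∈T} y i for the part of T already chosen.
  maxLevel : ∀ {n} → Subset n → (Fin n → Carrier) → ℕ → Carrier → Carrier
  maxLevel [] y zero s = 1#
  maxLevel [] y (suc k) s = (1# + s) * ι (+ 1 ℚ./ suc k)
  maxLevel (false ∷ S) y k s = maxLevel S (y ∘ suc) k s
  maxLevel (true ∷ S) y k s = maxLevel S (y ∘ suc) k s ⊓ maxLevel S (y ∘ suc) (suc k) (s + y zero)

  maxLevel-cong : ∀ {n} (S : Subset n) {y y′} k {s s′} → (∀ i → y i ≈ y′ i) → s ≈ s′ →
    maxLevel S y k s ≈ maxLevel S y′ k s′
  maxLevel-cong [] zero y≈y′ s≈s′ = ≈-refl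
  maxLevel-cong [] (suc k) y≈y′ s≈s′ = *-congʳ (+-congˡ s≈s′)
  maxLevel-cong (false ∷ S) k y≈y′ s≈s′ = maxLevel-cong S k (y≈y′ ∘ suc) s≈s′
  maxLevel-cong (true ∷ S) k y≈y′ s≈s′ = ⊓-cong (maxLevel-cong S k (y≈y′ ∘ suc) s≈s′)
    (maxLevel-cong S (suc k) (y≈y′ ∘ suc) (+-cong s≈s′ (y≈y′ zero)))

  maxLevel≤1 : ∀ {n} (S : Subset n) y s → maxLevel S y 0 s ≤ 1#
  maxLevel≤1 [] y s = ≤-refl
  maxLevel≤1 (false ∷ S) y s = maxLevel≤1 S (y ∘ suc) s
  maxLevel≤1 (true ∷ S) y s = ≤-trans (x⊓y≤x _ _) (maxLevel≤1 S (y ∘ suc) s)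

  poured : ∀ {n} → Subset n → (Fin n → Carrier) → Carrier → Carrier
  poured S y ℓ = ∑ S (λ i → 0# ⊔ (ℓ - y i))

  -- The `k` vertices already chosen contribute `ℓ - y i` without truncation, which gives the terms
  -- `k * ℓ` and `s`. For the next vertex, the two arguments of `0# ⊔ (ℓ - y zero)` correspond to
  -- leaving it out of T and to putting it in.
  poured-maxLevel : ∀ {n} (S : Subset n) y k s {ℓ} → 0# ≤ s → (∀ i → 0# ≤ y i) →
    ℓ ≤ maxLevel S y k s → ι (fromℕ k) * ℓ + poured S y ℓ ≤ 1# + s
  poured-maxLevel [] y zero s {ℓ} 0≤s 0≤y ℓ≤ = begin
    0# * ℓ + poured [] y ℓ   ≈⟨ +-congˡ (∑-[] _) ⟩
    0# * ℓ + 0#              ≤⟨ by-difference (0≤+ 0≤1# 0≤s)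
                                  (solve 2 (λ s ℓ → con 1ℚ :+ s := con 0ℚ :* ℓ :+ con 0ℚ :+ (con 1ℚ :+ s)) ≈-refl _ _) ⟩
    1# + s                   ∎
    where open ≤-Reasoning
  poured-maxLevel [] y (suc k) s {ℓ} 0≤s 0≤y ℓ≤ = begin
    K * ℓ + poured [] y ℓ    ≈⟨ ≈-trans (+-congˡ (∑-[] _)) (+-identityʳ _) ⟩
    K * ℓ                    ≤⟨ *-monoˡ-≤ (0≤ι-fromℕ (suc k)) ℓ≤ ⟩
    K * ((1# + s) * q)       ≈⟨ solve 3 (λ K s q → K :* (s :* q) := K :* q :* s) ≈-refl _ _ _ ⟩
    K * q * (1# + s)         ≈⟨ ≈-trans (*-congʳ (ι-fromℕ-*-1/ k)) (*-identityˡ _) ⟩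
    1# + s                   ∎
    where
    open ≤-Reasoning
    K = ι (fromℕ (suc k))
    q = ι (+ 1 ℚ./ suc k)
  poured-maxLevel (false ∷ S) y k s 0≤s 0≤y ℓ≤ = ≤-trans
    (≤-reflexive (+-congˡ (∑-false S _))) (poured-maxLevel S (y ∘ suc) k s 0≤s (0≤y ∘ suc) ℓ≤)
  poured-maxLevel (true ∷ S) y k s {ℓ} 0≤s 0≤y ℓ≤ = by-difference
    (sub-≥0 (⊔-lub unchosen chosen))
    (≈-trans (solve 4 (λ s kℓ p a → con 1ℚ :+ s := kℓ :+ (a :+ p) :+ (con 1ℚ :+ s :- (kℓ :+ p) :- a)) ≈-refl _ _ _ _)
             (+-congʳ (+-congˡ (≈-sym (∑-true S _)))))
    where
    rest = poured S (y ∘ suc) ℓ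
    unchosen : 0# ≤ 1# + s - (ι (fromℕ k) * ℓ + rest)
    unchosen = sub-≥0 (poured-maxLevel S (y ∘ suc) k s 0≤s (0≤y ∘ suc) (≤-trans ℓ≤ (x⊓y≤x _ _)))
    chosen : ℓ - y zero ≤ 1# + s - (ι (fromℕ k) * ℓ + rest)
    chosen = by-difference
      (sub-≥0 (poured-maxLevel S (y ∘ suc) (suc k) (s + y zero) (0≤+ 0≤s (0≤y zero)) (0≤y ∘ suc)
        (≤-trans ℓ≤ (x⊓y≤y _ _))))
      (≈-trans (solve 5 (λ s k ℓ r y → con 1ℚ :+ s :- (k :* ℓ :+ r) :=
          ℓ :- y :+ (con 1ℚ :+ (s :+ y) :- ((con 1ℚ :+ k) :* ℓ :+ r))) ≈-refl _ _ _ _ _)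
        (+-congˡ (+-congˡ (-‿cong (+-congʳ (*-congʳ (≈-sym (ι-fromℕ-suc k))))))))

  -- Converse of `poured-maxLevel`, by the same split. It gives maximality of the level and, applied
  -- to level 0, its nonnegativity.
  ≤-maxLevel : ∀ {n} (S : Subset n) y k s {ℓ} → ℓ ≤ 1# →
    ι (fromℕ k) * ℓ + poured S y ℓ ≤ 1# + s → ℓ ≤ maxLevel S y k s
  ≤-maxLevel [] y zero s ℓ≤1 _ = ℓ≤1
  ≤-maxLevel [] y (suc k) s {ℓ} ℓ≤1 fits = begin
    ℓ                            ≈⟨ ≈-trans (*-congʳ (ι-fromℕ-*-1/ k)) (*-identityˡ ℓ) ⟨
    K * q * ℓ                    ≈⟨ solve 3 (λ K q ℓ → K :* q :* ℓ := q :* (K :* ℓ)) ≈-refl _ _ _ ⟩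
    q * (K * ℓ)                  ≈⟨ *-congˡ (≈-trans (+-congˡ (∑-[] _)) (+-identityʳ _)) ⟨
    q * (K * ℓ + poured [] y ℓ)  ≤⟨ *-monoˡ-≤ (0≤ι-1/ k) fits ⟩
    q * (1# + s)                 ≈⟨ *-comm _ _ ⟩
    (1# + s) * q                 ∎
    where
    open ≤-Reasoning
    K = ι (fromℕ (suc k))
    q = ι (+ 1 ℚ./ suc k)
  ≤-maxLevel (false ∷ S) y k s ℓ≤1 fits = ≤-maxLevel S (y ∘ suc) k s ℓ≤1
    (≤-trans (≤-reflexive (+-congˡ (≈-sym (∑-false S _)))) fits)
  ≤-maxLevel (true ∷ S) y k s {ℓ} ℓ≤1 fits = ⊓-glb
    (≤-maxLevel S (y ∘ suc) k s ℓ≤1 (≤-trans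
      (by-difference (x≤x⊔y 0# (ℓ - y zero))
        (solve 3 (λ kℓ a p → kℓ :+ (a :+ p) := kℓ :+ p :+ a) ≈-refl _ _ _))
      fits′))
    (≤-maxLevel S (y ∘ suc) (suc k) (s + y zero) ℓ≤1 (≤-trans
      (≤-reflexive (+-congʳ (*-congʳ (ι-fromℕ-suc k))))
      (by-difference (0≤+ (sub-≥0 fits′) (sub-≥0 (y≤x⊔y 0# (ℓ - y zero))))
        (solve 6 (λ s y k ℓ a p → con 1ℚ :+ (s :+ y) :=
          (con 1ℚ :+ k) :* ℓ :+ p :+ (con 1ℚ :+ s :- (k :* ℓ :+ (a :+ p)) :+ (a :- (ℓ :- y)))) ≈-refl _ _ _ _ _ _))))
    where
    fits′ : ι (fromℕ k) * ℓ + (0# ⊔ (ℓ - y zero) + poured S (y ∘ suc) ℓ) ≤ 1# + s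
    fits′ = ≤-trans (≤-reflexive (+-congˡ (≈-sym (∑-true S _)))) fits

module Existence (𝔸 : OrderedAlgebra) {m n} (Γ : BipartiteGraph m n) (π : ArrivalOrder n) where
  open OrderedAlgebraProperties 𝔸
  open WaterFilling 𝔸 Γ π
  open Filling 𝔸

  levelOf : Allocation → Fin n → Carrier
  levelOf x j = maxLevel (nbr Γ j) (λ i → waterLevel x i j) 0 0#

  refill : Allocation → Allocation
  refill x i j = 0# ⊔ (levelOf x j - waterLevel x i j)

  -- refill x i j depends only on the values of x at vertices arriving before j,
  -- so after t rounds the vertices arriving before time t have their final values.
  rounds : ℕ → Allocation
  rounds zero _ _ = 0#
  rounds (suc t) = refill (rounds t)

  rounds-nonneg : ∀ t → NonNegative (rounds t)
  rounds-nonneg zero i j _ = ≤-refl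
  rounds-nonneg (suc t) i j _ = x≤x⊔y 0# _

  rounds-stable : ∀ t i j → time j ℕ.< t → rounds t i j ≈ rounds (suc t) i j
  rounds-stable (suc t) i j (ℕ.s≤s j≤t) = ⊔-cong ≈-refl
    (+-cong (maxLevel-cong (nbr Γ j) 0 same ≈-refl) (-‿cong (same i)))
    where
    same : ∀ k → waterLevel (rounds t) k j ≈ waterLevel (rounds (suc t)) k j
    same k = ∑-cong (nbrᴸ Γ k ∩ before (time j)) (λ j′ j′∈ → rounds-stable t k j′ (ℕ.<-≤-trans
      (∈-before⇒< (proj₂ (x∈p∩q⁻ (nbrᴸ Γ k) (before (time j)) j′∈))) j≤t))

  waterFilling : ∃[ x ] IsWaterFilling x
  waterFilling = x , λ j →
    -- All arrival times are below `n`, so `rounds n` is a fixed point of `refill`, which is the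
    -- equation required of the allocation.
    levelOf x j , (fillable j , largest j) , λ i _ → rounds-stable n i j (Fin.toℕ<n (π ⟨$⟩ʳ j))
    where
    x = rounds n

    0≤y : ∀ i j → 0# ≤ waterLevel x i j
    0≤y i j = 0≤level (rounds-nonneg n) i (time j)

    accumulate : ∀ {p ℓ} → 0# * ℓ + p ≈ p
    accumulate = solve 2 (λ p ℓ → con 0ℚ :* ℓ :+ p := p) ≈-refl _ _

    fillable : ∀ j → Fillable x j (levelOf x j)
    fillable j = ≤-maxLevel (nbr Γ j) _ 0 0# 0≤1# (begin
          0# * 0# + poured (nbr Γ j) (λ i → waterLevel x i j) 0#
            ≈⟨ accumulate ⟩
          poured (nbr Γ j) (λ i → waterLevel x i j) 0#
            ≤⟨ ∑-mono-≤ (nbr Γ j) (λ i _ → ⊔-lub ≤-refl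
                 (by-difference (0≤y i j) (solve 1 (λ y → con 0ℚ := con 0ℚ :- y :+ y) ≈-refl _))) ⟩
          ∑ (nbr Γ j) (λ _ → 0#)
            ≈⟨ ∑-0 (nbr Γ j) ⟩
          0#
            ≤⟨ 0≤1# ⟩
          1#
            ≈⟨ +-identityʳ 1# ⟨
          1# + 0# ∎)
      , maxLevel≤1 (nbr Γ j) _ 0#
      , ≤-trans (≤-reflexive (≈-sym accumulate)) (≤-trans
          (poured-maxLevel (nbr Γ j) _ 0 0# ≤-refl (λ i → 0≤y i j) ≤-refl)
          (≤-reflexive (+-identityʳ 1#)))
      where open ≤-Reasoning

    largest : ∀ j ℓ → Fillable x j ℓ → ℓ ≤ levelOf x j
    largest j ℓ (_ , ℓ≤1 , fits) = ≤-maxLevel (nbr Γ j) _ 0 0# ℓ≤1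
      (≤-trans (≤-reflexive accumulate) (≤-trans fits (≤-reflexive (≈-sym (+-identityʳ 1#)))))

-- The ratio for online degree at most d.

module CompetitiveRatio (𝔸 : OrderedAlgebra) {m n} (Γ : BipartiteGraph m n) (π : ArrivalOrder n)
  (d : ℕ) .{{_ : NonZero d}} (deg≤d : ∀ j → degree Γ j ℕ.≤ d) where
  open OrderedAlgebraProperties 𝔸
  open Taylor 𝔸
  open WaterFilling 𝔸 Γ π

  δ : ℚ
  δ = + 1 ℚ./ d

  c : ℚ
  c = + 1 ℚ./ 96

  0<δ : 0ℚ ℚ.< δ
  0<δ = ℚ.positive⁻¹ δ {{ℚ.normalize-pos 1 d}}

  0≤ιδ : 0# ≤ ι δ
  0≤ιδ = 0≤ι (ℚ.<⇒≤ 0<δ)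

  deg*δ≤1 : ∀ k → k ℕ.≤ d → ι (fromℕ k) * ι δ ≤ 1#
  deg*δ≤1 k k≤d = begin
    ι (fromℕ k) * ι δ   ≈⟨ ι-* _ _ ⟨
    ι (fromℕ k ℚ.* δ)   ≤⟨ ι-mono (ℚ.*-monoʳ-≤-nonNeg δ {{ℚ.nonNegative (ℚ.<⇒≤ 0<δ)}} (fromℕ-mono-≤ k≤d)) ⟩
    ι (fromℕ d ℚ.* δ)   ≡⟨ cong ι (fromℕ-*-1/ d) ⟩
    1#                  ∎
    where open ≤-Reasoning

  δ≤1 : ι δ ≤ 1#
  δ≤1 = ≤-trans (≤-reflexive (≈-sym (*-identityˡ _))) (deg*δ≤1 1 (ℕ.>-nonZero⁻¹ d))

  -- r plays the role of 1 - 1/e.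
  ratio : ∀ {r} → (∀ k → r ≤ 1# - ι (recip (eUpper (suc k)))) →
    ∀ {x z OPT} → IsWaterFilling x → IsFractionalMatching z → value z ≈ OPT →
    r * (1# + ι c * ι δ) * OPT ≤ value x
  ratio {r} r≤ {x} {z} {OPT} W Z z≈OPT = begin
    r * (1# + ι c * ι δ) * OPT
      ≈⟨ *-congˡ z≈OPT ⟨
    r * (1# + ι c * ι δ) * value z
      ≤⟨ by-difference (0≤* (0≤* (sub-≥0 (r≤ (1 ℕ.+ N))) 0≤1+cδ) 0≤value)
           (solve 4 (λ r ρ k v → ρ :* k :* v := r :* k :* v :+ (ρ :- r) :* k :* v) ≈-refl _ _ _ _) ⟩
    (1# - ι μ) * (1# + ι c * ι δ) * value z
      ≤⟨ Run.Charging.competitive x W potential 0≤ιδ (λ j → deg*δ≤1 (degree Γ j) (deg≤d j)) Z ⟩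
    value x ∎
    where
    open ≤-Reasoning
    cδ>0 : 0ℚ ℚ.< c ℚ.* δ
    cδ>0 = *-pos (ℚ.positive⁻¹ c) 0<δ
    -- Truncation so late that the tail bound `η` is at most `c * δ`, the error that the potential
    -- tolerates. The index `2 + N` is the degree of its `G`.
    N = proj₁ (archimedean (c ℚ.* δ) cδ>0)
    U = eUpper (2 ℕ.+ N)
    μ = recip U
    η = 1/! (2 ℕ.+ N)

    0≤1+cδ : 0# ≤ 1# + ι c * ι δ
    0≤1+cδ = 0≤+ 0≤1# (0≤* (0≤ι (ℚ.nonNegative⁻¹ c)) 0≤ιδ)

    0≤value : 0# ≤ value z
    0≤value = 0≤∑ ⊤ (λ j _ → 0≤∑ (nbr Γ j) (λ i → IsFractionalMatching.nonneg Z i j))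

    η≤cδ : ι η ≤ ι c * ι δ
    η≤cδ = ≤-trans (ι-mono (ℚ.≤-trans (1/!-suc-≤ N) (proj₂ (archimedean (c ℚ.* δ) cδ>0))))
      (≤-reflexive (ι-* _ _))

    1/3≤μ : + 1 ℚ./ 3 ℚ.≤ μ
    1/3≤μ = recip-antitone (0<eUpper (2 ℕ.+ N)) (eUpper≤3 (suc N))

    μ-inverse : ι μ * (exp (2 ℕ.+ N) 1# + ι η) ≈ 1#
    μ-inverse = begin-equality
      ι μ * (exp (2 ℕ.+ N) 1# + ι η)   ≈⟨ *-congˡ (+-congʳ (exp-1 (2 ℕ.+ N))) ⟩
      ι μ * (ι (eSeq (2 ℕ.+ N)) + ι η) ≈⟨ *-congˡ (ι-+ _ _) ⟨
      ι μ * ι U                        ≈⟨ ι-* _ _ ⟨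
      ι (μ ℚ.* U)                      ≡⟨ cong ι (≡.trans (ℚ.*-comm μ U) (*-recip (0<eUpper (2 ℕ.+ N)))) ⟩
      1#                               ∎

    potential : Potential 𝔸 (ι δ) ((1# - ι μ) * (1# + ι c * ι δ))
    potential = ExponentialPotential.potential 𝔸 N 0≤ιδ δ≤1 (0≤1/! (2 ℕ.+ N)) η≤cδ (ι-mono 1/3≤μ) μ-inverse

open import Defs

-- The Cauchy reals as an ordered algebra.

negate : ℝ → ℝ
negate x = mkℝ (λ n → ℚ.- seq x n) (neg-cauchy {seq x} (cauchy x))

eventually-≤ : ∀ x y N → (∀ n → N ℕ.≤ n → seq x n ℚ.≤ seq y n) → x ≤ y
eventually-≤ x y N x≤y ε 0<ε = N , λ n N≤n → ℚ.≤-trans (x≤y n N≤n)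
  (subst (ℚ._≤ seq y n ℚ.+ ε) (ℚ.+-identityʳ (seq y n)) (ℚ.+-monoʳ-≤ (seq y n) (ℚ.<⇒≤ 0<ε)))

pointwise-≤ : ∀ x y → (∀ n → seq x n ℚ.≤ seq y n) → x ≤ y
pointwise-≤ x y x≤y = eventually-≤ x y 0 (λ n _ → x≤y n)

pointwise-≃ : ∀ x y → (∀ n → seq x n ≡ seq y n) → x ≃ y
pointwise-≃ x y x≡y = pointwise-≤ x y (ℚ.≤-reflexive ∘ x≡y) , pointwise-≤ y x (ℚ.≤-reflexive ∘ ≡.sym ∘ x≡y)

≃-refl : ∀ x → x ≃ x
≃-refl x = pointwise-≃ x x (λ _ → refl)

≤-from-halves : ∀ {w x y z} u v → w ≤ x → y ≤ z →
  (∀ n ε → seq w n ℚ.≤ seq x n ℚ.+ ε → seq y n ℚ.≤ seq z n ℚ.+ ε → seq u n ℚ.≤ seq v n ℚ.+ (ε ℚ.+ ε)) →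
  u ≤ v
≤-from-halves u v w≤x y≤z combine ε 0<ε with w≤x (ε ℚ.* ½) (*-pos 0<ε 0<½) | y≤z (ε ℚ.* ½) (*-pos 0<ε 0<½)
... | M , p | N , q = M ℕ.⊔ N , λ n MN≤n → subst (λ ε → seq u n ℚ.≤ seq v n ℚ.+ ε) (halve ε)
  (combine n (ε ℚ.* ½) (p n (ℕ.m⊔n≤o⇒m≤o M N MN≤n)) (q n (ℕ.m⊔n≤o⇒n≤o M N MN≤n)))

≤-transitive : ∀ x y z → x ≤ y → y ≤ z → x ≤ z
≤-transitive x y z x≤y y≤z = ≤-from-halves {x} {y} {y} {z} x z x≤y y≤z λ n ε p q →
  ℚ.≤-trans p (ℚ.≤-trans (ℚ.+-monoˡ-≤ ε q) (ℚ.≤-reflexive (ℚ.+-assoc (seq z n) ε ε)))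

+-mono-≤ᴿ : ∀ w x y z → w ≤ x → y ≤ z → w + y ≤ x + z
+-mono-≤ᴿ w x y z w≤x y≤z = ≤-from-halves {w} {x} {y} {z} (w + y) (x + z) w≤x y≤z λ n ε p q →
  ℚ.≤-trans (ℚ.+-mono-≤ p q)
    (ℚ.≤-reflexive (solve 3 (λ x z ε → (x :+ ε) :+ (z :+ ε) := x :+ z :+ (ε :+ ε)) refl (seq x n) (seq z n) ε))
  where open ℚ.+-*-Solver

negate-antitone : ∀ x y → x ≤ y → negate y ≤ negate x
negate-antitone x y x≤y ε 0<ε with x≤y ε 0<ε
... | N , p = N , λ n N≤n → subst₂ ℚ._≤_
  (solve 3 (λ x y ε → x :- (x :+ y) := :- y) refl (seq x n) (seq y n) ε)
  (solve 3 (λ x y ε → (y :+ ε) :- (x :+ y) := :- x :+ ε) refl (seq x n) (seq y n) ε)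
  (ℚ.+-monoˡ-≤ (ℚ.- (seq x n ℚ.+ seq y n)) (p n N≤n))
  where
  open ℚ.+-*-Solver
  open ≡ using (subst₂)

⊔-lubᴿ : ∀ x y z → x ≤ z → y ≤ z → x ⊔ y ≤ z
⊔-lubᴿ x y z x≤z y≤z ε 0<ε with x≤z ε 0<ε | y≤z ε 0<ε
... | M , p | N , q = M ℕ.⊔ N , λ n MN≤n → ℚ.⊔-lub
  (p n (ℕ.m⊔n≤o⇒m≤o M N MN≤n)) (q n (ℕ.m⊔n≤o⇒n≤o M N MN≤n))

-- As `x` has no definite sign, both halves of `y ≃ z` are needed to bound the absolute difference
-- of `y` and `z`; it is then multiplied by an eventual bound on the absolute value of `x`.
*-congˡ-≤ : ∀ x y z → y ≃ z → x * y ≤ x * z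
*-congˡ-≤ x y z (y≤z , z≤y) ε 0<ε = from-bound (bound {seq x} (cauchy x))
  where
  open ℚ.+-*-Solver
  open ℚ.≤-Reasoning

  Goal : Set
  Goal = ∃[ N ] (∀ n → N ℕ.≤ n → seq x n ℚ.* seq y n ℚ.≤ seq x n ℚ.* seq z n ℚ.+ ε)

  product-≤ : ∀ a b c {B η} → ℚ.∣ a ∣ ℚ.≤ B → 0ℚ ℚ.≤ η → B ℚ.* η ≡ ε ℚ.* ½ →
    b ℚ.≤ c ℚ.+ η → c ℚ.≤ b ℚ.+ η → a ℚ.* b ℚ.≤ a ℚ.* c ℚ.+ ε
  product-≤ a b c {B} {η} a≤B 0≤η Bη≡ b≤c c≤b = close⇒≤ {a ℚ.* b} {a ℚ.* c} (begin
    ℚ.∣ a ℚ.* b ℚ.- a ℚ.* c ∣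
      ≡⟨ cong ℚ.∣_∣ (solve 3 (λ a b c → a :* b :- a :* c := a :* (b :- c)) refl a b c) ⟩
    ℚ.∣ a ℚ.* (b ℚ.- c) ∣
      ≡⟨ ℚ.∣p*q∣≡∣p∣*∣q∣ a (b ℚ.- c) ⟩
    ℚ.∣ a ∣ ℚ.* ℚ.∣ b ℚ.- c ∣
      ≤⟨ *-mono-≤-nonNeg (ℚ.0≤∣p∣ a) 0≤η a≤B (≤⇒close {b} {c} b≤c c≤b) ⟩
    B ℚ.* η
      ≡⟨ Bη≡ ⟩
    ε ℚ.* ½
      ≡⟨ ℚ.+-identityʳ (ε ℚ.* ½) ⟨
    ε ℚ.* ½ ℚ.+ 0ℚ
      ≤⟨ ℚ.+-monoʳ-≤ (ε ℚ.* ½) (ℚ.<⇒≤ (*-pos 0<ε 0<½)) ⟩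
    ε ℚ.* ½ ℚ.+ ε ℚ.* ½
      ≡⟨ halve ε ⟩
    ε ∎)

  from-bound : ∃[ B ] 0ℚ ℚ.< B × ∃[ K ] (∀ n → K ℕ.≤ n → ℚ.∣ seq x n ∣ ℚ.≤ B) → Goal
  from-bound (B , 0<B , K , x≤B) = from-tol (tol ε B 0<ε 0<B)
    where
    from-tol : ∃[ η ] 0ℚ ℚ.< η × B ℚ.* η ≡ ε ℚ.* ½ → Goal
    from-tol (η , 0<η , Bη≡) = combine (y≤z η 0<η) (z≤y η 0<η)
      where
      combine : ∃[ M ] (∀ n → M ℕ.≤ n → seq y n ℚ.≤ seq z n ℚ.+ η) →
                ∃[ N ] (∀ n → N ℕ.≤ n → seq z n ℚ.≤ seq y n ℚ.+ η) → Goal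
      combine (M , p) (N , q) = K ℕ.⊔ (M ℕ.⊔ N) , λ n KMN≤n →
        let MN≤n = ℕ.m⊔n≤o⇒n≤o K (M ℕ.⊔ N) KMN≤n
        in product-≤ (seq x n) (seq y n) (seq z n)
             (x≤B n (ℕ.m⊔n≤o⇒m≤o K (M ℕ.⊔ N) KMN≤n)) (ℚ.<⇒≤ 0<η) Bη≡
             (p n (ℕ.m⊔n≤o⇒m≤o M N MN≤n)) (q n (ℕ.m⊔n≤o⇒n≤o M N MN≤n))

*-comm-≃ : ∀ x y → x * y ≃ y * x
*-comm-≃ x y = pointwise-≃ (x * y) (y * x) (λ n → ℚ.*-comm (seq x n) (seq y n))

*-mono-≃ : ∀ w x y z → w ≃ x → y ≃ z → w * y ≤ x * z
*-mono-≃ w x y z w≃x y≃z = ≤-transitive (w * y) (w * z) (x * z) (*-congˡ-≤ w y z y≃z)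
  (≤-transitive (w * z) (z * w) (x * z) (proj₁ (*-comm-≃ w z))
    (≤-transitive (z * w) (z * x) (x * z) (*-congˡ-≤ z w x w≃x) (proj₁ (*-comm-≃ z x))))

0⊔x≃x : ∀ x → 0ℝ ≤ x → 0ℝ ⊔ x ≃ x
0⊔x≃x x 0≤x = ⊔-lubᴿ 0ℝ x x 0≤x (proj₁ (≃-refl x))
  , pointwise-≤ x (0ℝ ⊔ x) (λ n → ℚ.p≤q⊔p 0ℚ (seq x n))

-- A nonnegative real may have negative terms. Replacing each factor by its maximum with 0 changes
-- it only up to `≃` and makes the product nonnegative term by term.
0≤*ᴿ : ∀ x y → 0ℝ ≤ x → 0ℝ ≤ y → 0ℝ ≤ x * y
0≤*ᴿ x y 0≤x 0≤y = ≤-transitive 0ℝ ((0ℝ ⊔ x) * (0ℝ ⊔ y)) (x * y)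
  (pointwise-≤ 0ℝ ((0ℝ ⊔ x) * (0ℝ ⊔ y)) (λ n →
    *-mono-≤-nonNeg {0ℚ} {r = 0ℚ} ℚ.≤-refl (ℚ.p≤p⊔q 0ℚ (seq y n)) (ℚ.p≤p⊔q 0ℚ (seq x n)) (ℚ.p≤p⊔q 0ℚ (seq y n))))
  (*-mono-≃ (0ℝ ⊔ x) x (0ℝ ⊔ y) y (0⊔x≃x x 0≤x) (0⊔x≃x y 0≤y))

-- Exact comparison is undecidable, but with a tolerance a single rational comparison far enough
-- along both sequences decides.
compare : ∀ x y ε → 0ℚ ℚ.< ε →
  x < y ⊎ ∃[ N ] (∀ n → N ℕ.≤ n → seq y n ℚ.≤ seq x n ℚ.+ ε)
compare x y ε 0<ε = from (cauchy x θ 0<θ) (cauchy y θ 0<θ)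
  where
  open ℚ.+-*-Solver
  open ℚ.≤-Reasoning
  -- `θ` is ε/8 and `gap` is 3ε/4. Two fluctuations by `θ` turn the threshold `gap` into ε in one
  -- case and into ε/2 in the other.
  θ = ε ℚ.* ½ ℚ.* ½ ℚ.* ½
  gap = ε ℚ.* ½ ℚ.+ ε ℚ.* ½ ℚ.* ½
  0<θ = *-pos (*-pos (*-pos 0<ε 0<½) 0<½) 0<½

  Modulus : ℝ → Set
  Modulus x = ∃[ N ] (∀ m n → N ℕ.≤ m → N ℕ.≤ n → ℚ.∣ seq x m ℚ.- seq x n ∣ ℚ.≤ θ)

  from : Modulus x → Modulus y → x < y ⊎ ∃[ N ] (∀ n → N ℕ.≤ n → seq y n ℚ.≤ seq x n ℚ.+ ε)
  from (M , p) (N , q) = decide (seq y K ℚ.≤? seq x K ℚ.+ gap)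
    where
    K = M ℕ.⊔ N

    x-close : ∀ m n → K ℕ.≤ m → K ℕ.≤ n → seq x m ℚ.≤ seq x n ℚ.+ θ
    x-close m n K≤m K≤n = close⇒≤ {seq x m} {seq x n} (p m n (ℕ.m⊔n≤o⇒m≤o M N K≤m) (ℕ.m⊔n≤o⇒m≤o M N K≤n))

    y-close : ∀ m n → K ℕ.≤ m → K ℕ.≤ n → seq y m ℚ.≤ seq y n ℚ.+ θ
    y-close m n K≤m K≤n = close⇒≤ {seq y m} {seq y n} (q m n (ℕ.m⊔n≤o⇒n≤o M N K≤m) (ℕ.m⊔n≤o⇒n≤o M N K≤n))

    decide : Dec (seq y K ℚ.≤ seq x K ℚ.+ gap) → _
    decide (yes y≤x) = inj₂ (K , λ n K≤n → begin
      seq y n                        ≤⟨ y-close n K K≤n ℕ.≤-refl ⟩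
      seq y K ℚ.+ θ                  ≤⟨ ℚ.+-monoˡ-≤ θ y≤x ⟩
      seq x K ℚ.+ gap ℚ.+ θ          ≤⟨ ℚ.+-monoˡ-≤ θ (ℚ.+-monoˡ-≤ gap (x-close K n ℕ.≤-refl K≤n)) ⟩
      seq x n ℚ.+ θ ℚ.+ gap ℚ.+ θ    ≡⟨ solve 2 (λ x ε →
        x :+ ε :* con ½ :* con ½ :* con ½ :+ (ε :* con ½ :+ ε :* con ½ :* con ½)
          :+ ε :* con ½ :* con ½ :* con ½ := x :+ ε) refl (seq x n) ε ⟩
      seq x n ℚ.+ ε                  ∎)
    decide (no y≰x) = inj₁ (ε ℚ.* ½ , *-pos 0<ε 0<½ , K , λ n K≤n → begin
      seq x n ℚ.+ ε ℚ.* ½            ≤⟨ ℚ.+-monoˡ-≤ (ε ℚ.* ½) (x-close n K K≤n ℕ.≤-refl) ⟩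
      seq x K ℚ.+ θ ℚ.+ ε ℚ.* ½      ≡⟨ solve 2 (λ x ε →
        x :+ ε :* con ½ :* con ½ :* con ½ :+ ε :* con ½ :=
        x :+ (ε :* con ½ :+ ε :* con ½ :* con ½) :- ε :* con ½ :* con ½ :* con ½) refl (seq x K) ε ⟩
      seq x K ℚ.+ gap ℚ.- θ          ≤⟨ ℚ.+-monoˡ-≤ (ℚ.- θ) (ℚ.<⇒≤ (ℚ.≰⇒> y≰x)) ⟩
      seq y K ℚ.- θ                  ≤⟨ ≤⇒diff≤ {seq y K} {θ} {seq y n} (ℚ.≤-trans (y-close K n ℕ.≤-refl K≤n)
                                          (ℚ.≤-reflexive (ℚ.+-comm (seq y n) θ))) ⟩
      seq y n                        ∎)

<⇒≤ : ∀ x y → x < y → x ≤ y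
<⇒≤ x y (δ , 0<δ , N , x+δ≤y) = eventually-≤ x y N (λ n N≤n → ℚ.≤-trans
  (subst (ℚ._≤ seq x n ℚ.+ δ) (ℚ.+-identityʳ (seq x n)) (ℚ.+-monoʳ-≤ (seq x n) (ℚ.<⇒≤ 0<δ))) (x+δ≤y n N≤n))

<⇒≱ : ∀ x y → x < y → ¬ y ≤ x
<⇒≱ x y (δ , 0<δ , N , x+δ≤y) y≤x = clash (y≤x (δ ℚ.* ½) (*-pos 0<δ 0<½))
  where
  half< : δ ℚ.* ½ ℚ.< δ
  half< = ≡.subst₂ ℚ._<_ (ℚ.+-identityʳ (δ ℚ.* ½)) (halve δ) (ℚ.+-monoʳ-< (δ ℚ.* ½) (*-pos 0<δ 0<½))

  clash : ¬ (∃[ M ] (∀ n → M ℕ.≤ n → seq y n ℚ.≤ seq x n ℚ.+ δ ℚ.* ½))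
  clash (M , p) = ℚ.<-irrefl refl (ℚ.<-≤-trans (ℚ.+-monoʳ-< (seq x n) half<)
    (ℚ.≤-trans (x+δ≤y n (ℕ.m≤n⊔m M N)) (p n (ℕ.m≤m⊔n M N))))
    where n = M ℕ.⊔ N

≰⇒≥ : ∀ x y → ¬ x ≤ y → y ≤ x
≰⇒≥ x y x≰y ε 0<ε = [ (λ x<y → contradiction (<⇒≤ x y x<y) x≰y) , id ]′ (compare x y ε 0<ε)

-- For a given `ε`, `compare` yields either the wanted bound at `ε` or `y < x`, and the latter
-- contradicts the hypothesis.
≤-stable : ∀ x y → ¬ ¬ x ≤ y → x ≤ y
≤-stable x y ¬¬x≤y ε 0<ε = [ (λ y<x → contradiction (<⇒≱ y x y<x) ¬¬x≤y) , id ]′ (compare y x ε 0<ε)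

-- If the goal failed, `x ≤ y` would be refuted, hence `y ≤ x` would hold and give the goal.
-- Stability removes the double negation.
≤-casesᴿ : ∀ x y a b → (x ≤ y → a ≤ b) → (y ≤ x → a ≤ b) → a ≤ b
≤-casesᴿ x y a b f g = ≤-stable a b (λ a≰b → a≰b (g (≰⇒≥ x y (a≰b ∘ f))))

+-mono-≃ : ∀ w x y z → w ≃ x → y ≃ z → w + y ≃ x + z
+-mono-≃ w x y z (w≤x , x≤w) (y≤z , z≤y) = +-mono-≤ᴿ w x y z w≤x y≤z , +-mono-≤ᴿ x w z y x≤w z≤y

≃-trans : ∀ x y z → x ≃ y → y ≃ z → x ≃ z
≃-trans x y z (x≤y , y≤x) (y≤z , z≤y) = ≤-transitive x y z x≤y y≤z , ≤-transitive z y x z≤y y≤x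

ℝ-isCommutativeRing : IsCommutativeRing _≃_ _+_ _*_ negate 0ℝ 1ℝ
ℝ-isCommutativeRing = record
  { isRing = record
    { +-isAbelianGroup = record
      { isGroup = record
        { isMonoid = record
          { isSemigroup = record
            { isMagma = record
              { isEquivalence = record
                { refl = λ {x} → ≃-refl x
                ; sym = swap
                ; trans = λ {x y z} → ≃-trans x y z
                }
              ; ∙-cong = λ {w x y z} → +-mono-≃ w x y z
              }
            ; assoc = λ x y z → pointwise-≃ (x + y + z) (x + (y + z))
                (λ n → ℚ.+-assoc (seq x n) (seq y n) (seq z n))
            }
          ; identity = (λ x → pointwise-≃ (0ℝ + x) x (λ n → ℚ.+-identityˡ (seq x n)))
                     , (λ x → pointwise-≃ (x + 0ℝ) x (λ n → ℚ.+-identityʳ (seq x n)))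
          }
        ; inverse = (λ x → pointwise-≃ (negate x + x) 0ℝ (λ n → ℚ.+-inverseˡ (seq x n)))
                  , (λ x → pointwise-≃ (x + negate x) 0ℝ (λ n → ℚ.+-inverseʳ (seq x n)))
        ; ⁻¹-cong = λ {x y} (x≤y , y≤x) → negate-antitone y x y≤x , negate-antitone x y x≤y
        }
      ; comm = λ x y → pointwise-≃ (x + y) (y + x) (λ n → ℚ.+-comm (seq x n) (seq y n))
      }
    ; *-cong = λ {w x y z} w≃x y≃z → *-mono-≃ w x y z w≃x y≃z , *-mono-≃ x w z y (swap w≃x) (swap y≃z)
    ; *-assoc = λ x y z → pointwise-≃ (x * y * z) (x * (y * z))
        (λ n → ℚ.*-assoc (seq x n) (seq y n) (seq z n))
    ; *-identity = (λ x → pointwise-≃ (1ℝ * x) x (λ n → ℚ.*-identityˡ (seq x n)))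
                 , (λ x → pointwise-≃ (x * 1ℝ) x (λ n → ℚ.*-identityʳ (seq x n)))
    ; distrib = (λ x y z → pointwise-≃ (x * (y + z)) (x * y + x * z)
                  (λ n → ℚ.*-distribˡ-+ (seq x n) (seq y n) (seq z n)))
              , (λ x y z → pointwise-≃ ((y + z) * x) (y * x + z * x)
                  (λ n → ℚ.*-distribʳ-+ (seq x n) (seq y n) (seq z n)))
    }
  ; *-comm = *-comm-≃
  }

ℝ-isPartialOrder : IsPartialOrder _≃_ _≤_
ℝ-isPartialOrder = record
  { isPreorder = record
    { isEquivalence = IsCommutativeRing.isEquivalence ℝ-isCommutativeRing
    ; reflexive = proj₁
    ; trans = λ {x y z} → ≤-transitive x y z
    }
  ; antisym = _,_
  }

ℝ-orderedAlgebra : OrderedAlgebra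
ℝ-orderedAlgebra = record
  { Carrier = ℝ
  ; _≈_ = _≃_
  ; _≤_ = _≤_
  ; _+_ = _+_
  ; _*_ = _*_
  ; _⊔_ = _⊔_
  ; -_ = negate
  ; ι = fromℚ
  ; isCommutativeRing = ℝ-isCommutativeRing
  ; isPartialOrder = ℝ-isPartialOrder
  ; ι-+ = λ p q → pointwise-≃ (fromℚ (p ℚ.+ q)) (fromℚ p + fromℚ q) (λ _ → refl)
  ; ι-* = λ p q → pointwise-≃ (fromℚ (p ℚ.* q)) (fromℚ p * fromℚ q) (λ _ → refl)
  ; ι-neg = λ p → pointwise-≃ (fromℚ (ℚ.- p)) (negate (fromℚ p)) (λ _ → refl)
  ; ι-mono = λ {p q} p≤q → pointwise-≤ (fromℚ p) (fromℚ q) (λ _ → p≤q)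
  ; +-monoʳ-≤ = λ z {x y} → +-mono-≤ᴿ z z x y (proj₁ (≃-refl z))
  ; 0≤* = λ {x y} → 0≤*ᴿ x y
  ; x≤x⊔y = λ x y → pointwise-≤ x (x ⊔ y) (λ n → ℚ.p≤p⊔q (seq x n) (seq y n))
  ; y≤x⊔y = λ x y → pointwise-≤ y (x ⊔ y) (λ n → ℚ.p≤q⊔p (seq x n) (seq y n))
  ; ⊔-lub = λ {x y z} → ⊔-lubᴿ x y z
  ; ≤-cases = λ x y {a b} → ≤-casesᴿ x y a b
  ; ∑ = ∑
  ; ∑-[] = λ f → ≃-refl 0ℝ
  ; ∑-true = λ S f → ≃-refl (f zero + ∑ S (f ∘ suc))
  ; ∑-false = λ S f → ≃-refl (∑ S (f ∘ suc))
  }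

-- The constant 1 - 1/e, and the transfer to the definitions of the statement.

-- Each term of the left side is `1 - 1/E` for a partial sum `E`, which increases with `E`, and
-- every partial sum from index `suc k` on is at most `eUpper (suc k)`.
[e-1]/e-≤ : ∀ k → [e-1]/e ≤ 1ℝ - fromℚ (recip (eUpper (suc k)))
[e-1]/e-≤ k = eventually-≤ [e-1]/e (1ℝ - fromℚ (recip (eUpper (suc k)))) (suc k) λ n k<n → begin
  (eSeq n ℚ.- 1ℚ) ℚ.* recip (eSeq n)
    ≡⟨ solve 2 (λ E r → (E :- con 1ℚ) :* r := E :* r :- r) refl (eSeq n) (recip (eSeq n)) ⟩
  eSeq n ℚ.* recip (eSeq n) ℚ.- recip (eSeq n)
    ≡⟨ cong (ℚ._- recip (eSeq n)) (*-recip (0<eSeq n)) ⟩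
  1ℚ ℚ.- recip (eSeq n)
    ≤⟨ ℚ.+-monoʳ-≤ 1ℚ (ℚ.neg-antimono-≤ (recip-antitone (0<eSeq n) (eSeq≤ n k<n))) ⟩
  1ℚ ℚ.- recip (eUpper (suc k)) ∎
  where
  open ℚ.+-*-Solver
  open ℚ.≤-Reasoning
  eSeq≤ : ∀ n → suc k ℕ.≤ n → eSeq n ℚ.≤ eUpper (suc k)
  eSeq≤ n k<n = ℚ.≤-trans (eSeq≤eUpper n) (subst (λ n → eUpper n ℚ.≤ eUpper (suc k)) (ℕ.m∸n+n≡m k<n)
    (eSeq-upper (suc k) (n ℕ.∸ suc k) (ℕ.s≤s ℕ.z≤n)))

module _ {m n} (Γ : BipartiteGraph m n) (π : ArrivalOrder n) where
  private
    module 𝕎 = WaterFilling ℝ-orderedAlgebra Γ π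

  depth≃ : ∀ ℓ y → 0ℝ ⊔ (ℓ - y) ≃ 0ℝ ⊔ (ℓ + negate y)
  depth≃ ℓ y = pointwise-≃ (0ℝ ⊔ (ℓ - y)) (0ℝ ⊔ (ℓ + negate y)) (λ _ → refl)

  to-depth : ∀ x ℓ y → x ≃ 0ℝ ⊔ (ℓ - y) → x ≃ 0ℝ ⊔ (ℓ + negate y)
  to-depth x ℓ y x≃ = ≃-trans x (0ℝ ⊔ (ℓ - y)) (0ℝ ⊔ (ℓ + negate y)) x≃ (depth≃ ℓ y)

  from-depth : ∀ x ℓ y → x ≃ 0ℝ ⊔ (ℓ + negate y) → x ≃ 0ℝ ⊔ (ℓ - y)
  from-depth x ℓ y x≃ = ≃-trans x (0ℝ ⊔ (ℓ + negate y)) (0ℝ ⊔ (ℓ - y)) x≃ (swap (depth≃ ℓ y))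

  fillable : ∀ x j ℓ → (Fillable Γ π x j ℓ → 𝕎.Fillable x j ℓ) × (𝕎.Fillable x j ℓ → Fillable Γ π x j ℓ)
  fillable x j ℓ = 𝕎.Fillable-resp-≈ x j ℓ (λ i → 0ℝ ⊔ (ℓ - waterLevel Γ π x i j))
    (λ i → depth≃ ℓ (waterLevel Γ π x i j))

  toIsWaterFilling : ∀ x → IsWaterFilling Γ π x → 𝕎.IsWaterFilling x
  toIsWaterFilling x W j = at (W j)
    where
    at : ∃[ ℓ ] IsLargest (Fillable Γ π x j) ℓ
         × (∀ i → i ∈ nbr Γ j → x i j ≃ 0ℝ ⊔ (ℓ - waterLevel Γ π x i j)) → _
    at (ℓ , (F , largest) , x≃) =
        ℓ
      , (proj₁ (fillable x j ℓ) F , λ ℓ′ F′ → largest ℓ′ (proj₂ (fillable x j ℓ′) F′))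
      , λ i i∈ → to-depth (x i j) ℓ (waterLevel Γ π x i j) (x≃ i i∈)

  fromIsWaterFilling : ∀ x → 𝕎.IsWaterFilling x → IsWaterFilling Γ π x
  fromIsWaterFilling x W j = at (W j)
    where
    at : ∃[ ℓ ] (𝕎.Fillable x j ℓ × (∀ ℓ′ → 𝕎.Fillable x j ℓ′ → ℓ′ ≤ ℓ))
         × (∀ i → i ∈ nbr Γ j → x i j ≃ 0ℝ ⊔ (ℓ + negate (waterLevel Γ π x i j))) → _
    at (ℓ , (F , largest) , x≃) =
        ℓ
      , (proj₂ (fillable x j ℓ) F , λ ℓ′ F′ → largest ℓ′ (proj₁ (fillable x j ℓ′) F′))
      , λ i i∈ → from-depth (x i j) ℓ (waterLevel Γ π x i j) (x≃ i i∈)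

  waterFilling-exists : ∃[ x ] IsWaterFilling Γ π x
  waterFilling-exists =
    map₂ (λ {x} → fromIsWaterFilling x) (Existence.waterFilling ℝ-orderedAlgebra Γ π)

  waterFilling-isFractionalMatching : ∀ x → 𝕎.IsWaterFilling x → IsFractionalMatching Γ x
  waterFilling-isFractionalMatching x W = record { nonneg = M.nonneg ; offline = M.offline ; online = M.online }
    where
    module M = 𝕎.IsFractionalMatching (𝕎.Run.isFractionalMatching x W)

  waterFilling-competitive : ∀ d .{{_ : NonZero d}} → (∀ j → degree Γ j ℕ.≤ d) →
    ∀ x z OPT → 𝕎.IsWaterFilling x → IsFractionalMatching Γ z → value Γ z ≃ OPT →
    ([e-1]/e * (1ℝ + fromℚ (+ 1 ℚ./ 96) / d)) * OPT ≤ value Γ x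
  waterFilling-competitive d deg≤d x z OPT W Z z≃OPT =
    CompetitiveRatio.ratio ℝ-orderedAlgebra Γ π d deg≤d {[e-1]/e} [e-1]/e-≤ {x} {z} {OPT} W
      (record { nonneg = Z.nonneg ; offline = Z.offline ; online = Z.online }) z≃OPT
    where
    module Z = IsFractionalMatching Z

theorem2 : ∃[ c ] (0ℝ < c) ×
    ((d : ℕ) .{{_ : NonZero d}} (m n : ℕ) (G : BipartiteGraph m n) →
    (∀ j → degree G j ℕ.≤ d) →
    (π : ArrivalOrder n) →
    (∃[ x ] IsWaterFilling G π x) ×
    (∀ x → IsWaterFilling G π x →
    IsFractionalMatching G x ×
    (∀ OPT → IsOPT G OPT → ([e-1]/e * (1ℝ + c / d)) * OPT ≤ value G x)))
theorem2 = fromℚ (+ 1 ℚ./ 96)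
  , (+ 1 ℚ./ 96 , ℚ.positive⁻¹ (+ 1 ℚ./ 96) , 0 , λ _ _ → ℚ.≤-reflexive (ℚ.+-identityˡ (+ 1 ℚ./ 96)))
  , λ d m n G deg≤d π → waterFilling-exists G π
    , λ x W → waterFilling-isFractionalMatching G π x (toIsWaterFilling G π x W)
      , λ { OPT ((z , Z , z≃OPT) , _) →
            waterFilling-competitive G π d deg≤d x z OPT (toIsWaterFilling G π x W) Z z≃OPT }
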